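{- Algorithm 2 computes a feasible solution to the Side-Access Compact Retrieval Problem (SACRP) in $O(n^3)$ time, where $n$ is the number of targets.
   Context: SACRP. A slice is a sequence of stacks $T=(1,\dots,m)$, indexed from the entry side (stack $1$) outward; "left" means smaller index. Stack $t$ initially consists of $h(t)\ge 0$ unit loads (ULs) stacked without gaps; a UL at height $k$ has exactly $k$ ULs below it in its stack. A pick-list $\mathcal B$ of $n$ target ULs is given; target $b$ lies in stack $s(b)$ at initial height $h(b)$; $R(b)$ is the number of targets initially below $b$ in its stack. Retrieval proceeds in cycles $c=1,2,\dots$; $h_c(t)$, $h_c(b)$ are the heights of stack $t$ and of a not-yet-retrieved target $b$ at the start of cycle $c$ ($h_1=h$). In cycle $c$ one chooses clearance levels $\ell_c(t)\in\{0,\dots,h_c(t)\}$: the top $e_c(t)=h_c(t)-\ell_c(t)$ ULs of stack $t$ are lifted for the whole cycle. Then a sequence $(b_{c,1},\dots,b_{c,k})$ of targets is retrieved, with residual heights $d_{c,0}=\ell_c$ and $d_{c,i}(t)=d_{c,i-1}(t)-[t=s(b_{c,i})]$. Retrieving $b$ (stack $t$, height $h=h_c(b)$) as the $i$-th retrieval requires accessibility: $d_{c,i-1}(t)=h+1$ and $d_{c,i-1}(t')=h$ for all $t'<t$. Afterwards lifted ULs are lowered, $h_{c+1}(t)=d_{c,k}(t)+e_c(t)$, and each remaining target drops by the number of targets retrieved in cycle $c$ below it in its stack. Non-targets are never removed. A solution is feasible if every target is retrieved exactly once and is accessible when retrieved. An instance is feasible iff for all targets $b$ and all stacks $t<s(b)$,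 $h(t)\ge h(b)-R(b)$; the input instance is assumed feasible. Batch extension rules. In a cycle $c$, let $Y$ be the current batch with anchor $b(Y)$ (a target of $Y$ of maximum stack index), $s(Y)=s(b(Y))$, $h(Y)=h_c(b(Y))$; a candidate $b\notin Y$ not yet retrieved with $s=s(b)\le s(Y)$ and $h=h_c(b)$ may be added if one of: (C1) $h=h(Y)$; (C2) for every $s'\le s$, the position in stack $s'$ at height $h-1$ is occupied by a target of $Y$; (C3) [$h=h(Y)-1$ or the position in stack $s$ at height $h+1$ is occupied by a target of $Y$] and [$s=1$ or the position in stack $s-1$ at height $h$ is occupied by a target of $Y$]. A target $b$ is legal (given the already retrieved targets and the current batch $Y$) if (i) it is accessible, (ii) it can be added to $Y$ via (C1), (C2) or (C3), and (iii) after retrieving it the remaining instance still satisfies the feasibility condition above. Algorithm 2. Repeat until all targets are retrieved: start a new cycle; let $b$ be a not-yet-retrieved target of maximum current height (ties broken towards the rightmost stack); among the accessible targets in stack $s(b)$ let $b'$ be the topmost; set $Y=\{b'\}$ and iteratively add to $Y$ any legal target until none exists; retrieve all targets of $Y$ in this cycle.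
   Formalization: The O(n^3) bound (unit-cost RAM) is proved after a separate O(m) pass over the m stack heights, as no bound in n alone allows reading them; clearance levels are output implicitly, by one number per cycle, instead of being written out for all m stacks. -}

module Defs where

open import Data.Bool.Base using (Bool; true; false; if_then_else_; not)
open import Data.Fin.Base using (Fin; zero; suc; toℕ)
import Data.Fin.Base as Fin
import Data.Fin.Properties as Fin
open import Data.List.Base
  using (List; []; _∷_; [_]; _++_; length; filter; foldl; foldr; map; concatMap; allFin; lookup)
open import Data.List.Membership.Propositional using (_∈_; _∉_)
open import Data.List.Relation.Binary.Permutation.Propositional using (_↭_)
open import Data.Nat.Base
  using (ℕ; zero; suc; _+_; _∸_; _⊓_; _⊔_; _≤_; _<_; _≤ᵇ_; _<ᵇ_; _≡ᵇ_)
open import Data.Nat.Properties using (_≟_; _<?_)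
open import Data.Product.Base using (_×_; _,_; ∃-syntax)
open import Data.Sum.Base using (_⊎_)
open import Data.Unit.Base using (⊤; tt)
open import Data.Vec.Functional using (Vector; updateAt; tail) renaming (_∷_ to _◂_; [] to ◂[])
open import Function.Base using (_∘_; const)
open import Relation.Binary.PropositionalEquality.Core using (_≡_)
open import Relation.Nullary using (¬_; Dec; does)
open import Relation.Nullary.Decidable using (_×-dec_; ¬?)

------------------------------------------------------------------------
-- The problem

-- Stacks are `Fin m` and targets `Fin n`; the stack next to the entry side is
-- `zero`.

record Instance (m n : ℕ) : Set where
  field
    stackHeight : Fin m → ℕ
    stack       : Fin n → Fin m
    height      : Fin n → ℕ
    height<     : ∀ b → height b < stackHeight (stack b)
    distinct    : ∀ {b b′} → stack b ≡ stack b′ → height b ≡ height b′ → b ≡ b′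

record Cycle (m n : ℕ) : Set where
  constructor mkCycle
  field
    level : Fin m → ℕ
    order : List (Fin n)

Solution : ℕ → ℕ → Set
Solution m n = List (Cycle m n)

module _ {m n : ℕ} (I : Instance m n) where
  open Instance I

  -- In this module `hs` and `hb` are the heights of stacks and of targets at
  -- the start of a cycle, and `d` is a vector of residual heights.

  AccessibleAt : (hb : Fin n → ℕ) (d : Fin m → ℕ) → Fin n → Set
  AccessibleAt hb d b =
    d (stack b) ≡ suc (hb b) × (∀ t → t Fin.< stack b → d t ≡ hb b)

  lower : (Fin m → ℕ) → Fin n → (Fin m → ℕ)
  lower d b t = if does (t Fin.≟ stack b) then d t ∸ 1 else d t

  Retrievable : (hb : Fin n → ℕ) (d : Fin m → ℕ) → List (Fin n) → Set
  Retrievable hb d []       = ⊤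
  Retrievable hb d (b ∷ bs) = AccessibleAt hb d b × Retrievable hb (lower d b) bs

  nextStacks : (hs : Fin m → ℕ) → Cycle m n → (Fin m → ℕ)
  nextStacks hs (mkCycle ℓ bs) t = foldl lower ℓ bs t + (hs t ∸ ℓ t)

  nextTargets : (hb : Fin n → ℕ) → List (Fin n) → (Fin n → ℕ)
  nextTargets hb bs b =
    hb b ∸ length (filter (λ y → (stack y Fin.≟ stack b) ×-dec (hb y <? hb b)) bs)

  ValidFrom : (hs : Fin m → ℕ) (hb : Fin n → ℕ) → Solution m n → Set
  ValidFrom hs hb []                 = ⊤
  ValidFrom hs hb (c@(mkCycle ℓ bs) ∷ cs) =
    (∀ t → ℓ t ≤ hs t) ×
    Retrievable hb ℓ bs ×
    ValidFrom (nextStacks hs c) (nextTargets hb bs) cs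

  FeasibleSolution : Solution m n → Set
  FeasibleSolution cs =
    ValidFrom stackHeight height cs × (concatMap Cycle.order cs ↭ allFin n)

  ----------------------------------------------------------------------
  -- The remaining instance, once the targets in D have been retrieved

  open import Data.List.Membership.DecPropositional (Fin._≟_ {n}) using (_∈?_)

  below? : ∀ b y → Dec (stack y ≡ stack b × height y < height b)
  below? b y = (stack y Fin.≟ stack b) ×-dec (height y <? height b)

  stackHeightᴰ : List (Fin n) → Fin m → ℕ
  stackHeightᴰ D t = stackHeight t ∸ length (filter (λ y → stack y Fin.≟ t) D)

  heightᴰ : List (Fin n) → Fin n → ℕ
  heightᴰ D b = height b ∸ length (filter (below? b) D)

  Rᴰ : List (Fin n) → Fin n → ℕ
  Rᴰ D b = length (filter (λ y → below? b y ×-dec ¬? (y ∈? D)) (allFin n))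

  -- `Feasible []` is feasibility of the instance itself.
  Feasible : List (Fin n) → Set
  Feasible D = ∀ b → b ∉ D → ∀ t → t Fin.< stack b →
               heightᴰ D b ∸ Rᴰ D b ≤ stackHeightᴰ D t

  ----------------------------------------------------------------------
  -- The algorithm, as a nondeterministic procedure

  -- Throughout, D is the set of targets retrieved in earlier cycles and Y the
  -- current batch; D alone determines the heights of the current cycle.

  -- Some choice of clearance levels makes b accessible.
  Accessible : List (Fin n) → Fin n → Set
  Accessible D b = ∃[ ℓ ] (∀ t → ℓ t ≤ stackHeightᴰ D t) × AccessibleAt (heightᴰ D) ℓ b

  Occupied : (D Y : List (Fin n)) → Fin m → ℕ → Set
  Occupied D Y t k = ∃[ y ] y ∈ Y × stack y ≡ t × heightᴰ D y ≡ k

  Anchor : (Y : List (Fin n)) → Fin n → Set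
  Anchor Y a = a ∈ Y × (∀ y → y ∈ Y → stack y Fin.≤ stack a)

  C1 C2 C3 : (D Y : List (Fin n)) (a b : Fin n) → Set
  C1 D Y a b = heightᴰ D b ≡ heightᴰ D a
  C2 D Y a b = ∃[ k ] heightᴰ D b ≡ suc k × (∀ t → t Fin.≤ stack b → Occupied D Y t k)
  C3 D Y a b =
    (suc (heightᴰ D b) ≡ heightᴰ D a ⊎ Occupied D Y (stack b) (suc (heightᴰ D b))) ×
    (toℕ (stack b) ≡ 0 ⊎
     (∃[ t ] suc (toℕ t) ≡ toℕ (stack b) × Occupied D Y t (heightᴰ D b)))

  record Legal (D Y : List (Fin n)) (a b : Fin n) : Set where
    field
      notRetrieved  : b ∉ D
      notInBatch    : b ∉ Y
      accessible    : Accessible D b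
      left          : stack b Fin.≤ stack a
      extends       : C1 D Y a b ⊎ C2 D Y a b ⊎ C3 D Y a b
      staysFeasible : Feasible (b ∷ Y ++ D)

  Highest : List (Fin n) → Fin n → Set
  Highest D b = b ∉ D × (∀ x → x ∉ D →
    heightᴰ D x < heightᴰ D b ⊎ (heightᴰ D x ≡ heightᴰ D b × stack x Fin.≤ stack b))

  Initial : List (Fin n) → Fin n → Set
  Initial D b′ = ∃[ b ] Highest D b ×
    b′ ∉ D × stack b′ ≡ stack b × Accessible D b′ ×
    (∀ x → x ∉ D → stack x ≡ stack b → Accessible D x → heightᴰ D x ≤ heightᴰ D b′)

  -- Which target of maximum stack index serves as the anchor is left open, and
  -- may change from one extension to the next.
  data Batch (D : List (Fin n)) : List (Fin n) → Set where
    start  : ∀ {b′} → Initial D b′ → Batch D [ b′ ]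
    extend : ∀ {Y a b} → Batch D Y → Anchor Y a → Legal D Y a b → Batch D (b ∷ Y)

  data Run (D : List (Fin n)) : List (List (Fin n)) → Set where
    finished : (∀ b → b ∈ D) → Run D []
    cycle    : ∀ {Y Ys a} → Batch D Y → Anchor Y a → (∀ b → ¬ Legal D Y a b) →
               Run (Y ++ D) Ys → Run D (Y ∷ Ys)

------------------------------------------------------------------------
-- Time on a unit-cost RAM

-- Reading or writing an array cell, an arithmetic operation or comparison on
-- naturals, a Boolean connective, and visiting a list cell each cost 1.  The
-- program below inspects data only through the operations of this section and
-- by testing a list for emptiness.  `write` overwrites its argument in place:
-- where the old contents are used again, the array is copied first.

record Timed (A : Set) : Set where
  constructor _after_
  field
    value : A
    cost  : ℕ
open Timed public

private variable
  A B : Set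
  k   : ℕ

return : A → Timed A
return x = x after 0

_>>=_ : Timed A → (A → Timed B) → Timed B
x >>= f = value (f (value x)) after (cost x + cost (f (value x)))

_>>_ : Timed A → Timed B → Timed B
x >> y = x >>= λ _ → y

tick : Timed ⊤
tick = tt after 1

op₁ : (A → B) → Timed A → Timed B
op₁ f x = do
  a ← x
  tick
  return (f a)

op₂ : (A → A → B) → Timed A → Timed A → Timed B
op₂ f x y = do
  a ← x
  b ← y
  tick
  return (f a b)

infixl 9 _!_
_!_ : Vector A k → Fin k → Timed A
xs ! i = xs i after 1

write : Vector A k → Fin k → A → Timed (Vector A k)
write xs i v = updateAt xs i (const v) after 1

copyᵗ : Vector A k → Timed (Vector A k)
copyᵗ {k = k} xs = xs after k

infixl 6 _∸ᵗ_
infix  4 _≤ᵗ_ _<ᵗ_ _==ᵗ_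
infixr 3 _∧ᵗ_
infixr 2 _∨ᵗ_

sucᵗ predᵗ : Timed ℕ → Timed ℕ
sucᵗ  = op₁ suc
predᵗ = op₁ (_∸ 1)

_∸ᵗ_ _⊓ᵗ_ : Timed ℕ → Timed ℕ → Timed ℕ
_∸ᵗ_ = op₂ _∸_
_⊓ᵗ_ = op₂ _⊓_

_≤ᵗ_ _<ᵗ_ _==ᵗ_ : Timed ℕ → Timed ℕ → Timed Bool
_≤ᵗ_  = op₂ _≤ᵇ_
_<ᵗ_  = op₂ _<ᵇ_
_==ᵗ_ = op₂ _≡ᵇ_

notᵗ : Timed Bool → Timed Bool
notᵗ = op₁ not

_∧ᵗ_ _∨ᵗ_ : Timed Bool → Timed Bool → Timed Bool
p ∧ᵗ q = do
  a ← p
  tick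
  if a then q else return false
p ∨ᵗ q = do
  a ← p
  tick
  if a then return true else q

foldlᵗ : (A → B → Timed A) → A → List B → Timed A
foldlᵗ f a []       = a after 1
foldlᵗ f a (x ∷ xs) = do
  tick
  a′ ← f a x
  foldlᵗ f a′ xs

allᵗ anyᵗ : (A → Timed Bool) → List A → Timed Bool
allᵗ p []       = true after 1
allᵗ p (x ∷ xs) = p x ∧ᵗ allᵗ p xs
anyᵗ p []       = false after 1
anyᵗ p (x ∷ xs) = p x ∨ᵗ anyᵗ p xs

filterᵗ : (A → Timed Bool) → List A → Timed (List A)
filterᵗ p []       = [] after 1
filterᵗ p (x ∷ xs) = do
  tick
  a  ← p x
  ys ← filterᵗ p xs
  return (if a then x ∷ ys else ys)

countᵗ : (A → Timed Bool) → List A → Timed ℕ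
countᵗ p []       = 0 after 1
countᵗ p (x ∷ xs) = do
  tick
  a ← p x
  c ← countᵗ p xs
  if a then sucᵗ (return c) else return c

tabulateᵗ : (Fin k → Timed A) → Timed (Vector A k)
tabulateᵗ {k = zero}  f = return ◂[]
tabulateᵗ {k = suc k} f = do
  tick
  x  ← f zero
  xs ← tabulateᵗ (f ∘ suc)
  return (x ◂ xs)

lookupᵗ : (xs : List A) → Fin (length xs) → Timed A
lookupᵗ xs i = lookup xs i after length xs

------------------------------------------------------------------------
-- The algorithm, as a timed program

scanMin : ℕ → Vector ℕ k → Timed (Vector ℕ k)
scanMin {zero}  acc h = return ◂[]
scanMin {suc k} acc h = do
  x  ← return acc ⊓ᵗ (h ! zero)
  xs ← scanMin x (tail h)
  tick
  return (x ◂ xs)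

-- Entry t is the minimum of h t′ over t′ ≤ t.
prefixMinima : Vector ℕ k → Timed (Vector ℕ k)
prefixMinima {zero}  h = return ◂[]
prefixMinima {suc k} h = do
  x ← h ! zero
  scanMin x h

-- Resolves "add any legal target": given the candidates, the current batch and
-- the number (minus one) of legal candidates, the index of the one to be added.
-- Each state occurs at most once in a run, so every way of choosing is covered.
Chooser : ℕ → Set
Chooser n = (cand Y : List (Fin n)) (l : ℕ) → Fin (suc l)

-- A cycle as output by the program: writing out all m clearance levels in each
-- cycle would take time depending on m, so they are encoded by the height
-- `base` of the first target of the batch, see `levels`.
record Plan (n : ℕ) : Set where
  constructor mkPlan
  field
    base     : ℕ
    sequence : List (Fin n)

record State (m n : ℕ) : Set where
  constructor mkState
  field
    hs : Vector ℕ m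
    hb : Vector ℕ n
    rb : Vector ℕ n
    remaining : List (Fin n)

module _ {m n : ℕ} (I : Instance m n) where
  open Instance I

  levels : (hs : Fin m → ℕ) (hb : Fin n → ℕ) → Plan n → Fin m → ℕ
  levels hs hb (mkPlan base bs) t =
    foldr _⊔_ (base ⊓ hs t) (map (suc ∘ hb) (filter (λ y → stack y Fin.≟ t) bs))

  decodeFrom : (hs : Fin m → ℕ) (hb : Fin n → ℕ) → List (Plan n) → Solution m n
  decodeFrom hs hb []       = []
  decodeFrom hs hb (p ∷ ps) =
    let bs = Plan.sequence p
        c  = mkCycle (levels hs hb p) bs
    in  c ∷ decodeFrom (nextStacks I hs c) (nextTargets I hb bs) ps

  decode : List (Plan n) → Solution m n
  decode = decodeFrom stackHeight height

  col : Fin n → Timed ℕ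
  col b = do
    t ← stack ! b
    return (toℕ t)

  belowᵗ : (hb : Vector ℕ n) (b y : Fin n) → Timed Bool
  belowᵗ hb b y = (col y ==ᵗ col b) ∧ᵗ (hb ! y <ᵗ hb ! b)

  -- The heights of stacks without targets never change, and those of the
  -- others only decrease; so, with `low` the prefix minima of the initial stack
  -- heights, it suffices to compare with `low` and the stacks of all targets.
  accessibleᵗ : (low : Vector ℕ m) (hs : Vector ℕ m) (hb : Vector ℕ n) → Fin n → Timed Bool
  accessibleᵗ low hs hb b = do
    t ← stack ! b
    (hb ! b ≤ᵗ low ! t) ∧ᵗ
      allᵗ (λ x → (col b ≤ᵗ col x) ∨ᵗ (hb ! b ≤ᵗ ((stack ! x) >>= (hs !_)))) (allFin n)

  module _ (low hs : Vector ℕ m) (hb rb : Vector ℕ n) where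

    -- For C2: Y meets all stacks up to that of b at the height below b iff it
    -- has as many targets there as there are such stacks.
    c1ᵗ c2ᵗ c3ᵗ : (a : Fin n) (Y : List (Fin n)) (b : Fin n) → Timed Bool
    c1ᵗ a Y b = hb ! b ==ᵗ hb ! a
    c2ᵗ a Y b =
      countᵗ (λ y → (col y ≤ᵗ col b) ∧ᵗ (sucᵗ (hb ! y) ==ᵗ hb ! b)) Y ==ᵗ sucᵗ (col b)
    c3ᵗ a Y b =
      ((sucᵗ (hb ! b) ==ᵗ hb ! a) ∨ᵗ
        anyᵗ (λ y → (col y ==ᵗ col b) ∧ᵗ (hb ! y ==ᵗ sucᵗ (hb ! b))) Y) ∧ᵗ
      ((col b ==ᵗ return 0) ∨ᵗ
        anyᵗ (λ y → (sucᵗ (col y) ==ᵗ col b) ∧ᵗ (hb ! y ==ᵗ hb ! b)) Y)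

    -- Retrieving b only lowers its own stack, and the difference between the
    -- height of a remaining target and the number of remaining targets below it
    -- never changes; so only this one stack has to be tested.
    staysFeasibleᵗ : (cand Y : List (Fin n)) (b : Fin n) → Timed Bool
    staysFeasibleᵗ cand Y b = do
      t ← stack ! b
      h ← hs ! t ∸ᵗ sucᵗ (countᵗ (λ y → col y ==ᵗ col b) Y)
      allᵗ (λ x → (col x ≤ᵗ col b) ∨ᵗ (hb ! x ∸ᵗ rb ! x ≤ᵗ return h)) cand

    legalᵗ : (a : Fin n) (cand Y : List (Fin n)) (b : Fin n) → Timed Bool
    legalᵗ a cand Y b =
      accessibleᵗ low hs hb b ∧ᵗ
      (col b ≤ᵗ col a) ∧ᵗ
      (c1ᵗ a Y b ∨ᵗ c2ᵗ a Y b ∨ᵗ c3ᵗ a Y b) ∧ᵗ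
      staysFeasibleᵗ cand Y b

    removeᵗ : Fin n → List (Fin n) → Timed (List (Fin n))
    removeᵗ b = filterᵗ (λ x → notᵗ (return (toℕ x) ==ᵗ return (toℕ b)))

    -- The first argument bounds the number of extensions; `length cand` is
    -- enough.  The result is the batch and the targets that remain after it.
    growᵗ : ℕ → Chooser n → (a : Fin n) (cand Y : List (Fin n)) →
            Timed (List (Fin n) × List (Fin n))
    pickᵗ : ℕ → Chooser n → (a : Fin n) (cand Y legal : List (Fin n)) →
            Timed (List (Fin n) × List (Fin n))

    growᵗ zero       choose a cand Y = return (Y , cand)
    growᵗ (suc fuel) choose a cand Y = do
      ls ← filterᵗ (legalᵗ a cand Y) cand
      pickᵗ fuel choose a cand Y ls

    pickᵗ fuel choose a cand Y []           = return (Y , cand)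
    pickᵗ fuel choose a cand Y ls@(_ ∷ ls′) = do
      b     ← lookupᵗ ls (choose cand Y (length ls′))
      cand′ ← removeᵗ b cand
      growᵗ fuel choose a cand′ (b ∷ Y)

    highestᵗ : Fin n → List (Fin n) → Timed (Fin n)
    highestᵗ = foldlᵗ λ b x → do
      p ← (hb ! b <ᵗ hb ! x) ∨ᵗ (hb ! b ==ᵗ hb ! x) ∧ᵗ (col b ≤ᵗ col x)
      return (if p then x else b)

    accessibleInᵗ : Fin n → List (Fin n) → Timed (List (Fin n))
    accessibleInᵗ b =
      filterᵗ (λ x → (col x ==ᵗ col b) ∧ᵗ accessibleᵗ low hs hb x)

    -- Insertion sort into the order of retrieval: from top to bottom and, at
    -- equal heights, from left to right.
    insertᵗ : Fin n → List (Fin n) → Timed (List (Fin n))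
    insertᵗ y []       = [ y ] after 1
    insertᵗ y (z ∷ zs) = do
      p ← (hb ! z <ᵗ hb ! y) ∨ᵗ (hb ! z ==ᵗ hb ! y) ∧ᵗ (col y ≤ᵗ col z)
      if p then return (y ∷ z ∷ zs) else do
        tick
        zs′ ← insertᵗ y zs
        return (z ∷ zs′)

    sortᵗ : List (Fin n) → Timed (List (Fin n))
    sortᵗ = foldlᵗ (λ ys y → insertᵗ y ys) []

    dropStackᵗ : Vector ℕ m → Fin n → Timed (Vector ℕ m)
    dropStackᵗ v y = do
      t ← stack ! y
      h ← predᵗ (v ! t)
      write v t h

    dropTargetᵗ : (Y : List (Fin n)) → Vector ℕ n → Fin n → Timed (Vector ℕ n)
    dropTargetᵗ Y v x = do
      h ← v ! x ∸ᵗ countᵗ (belowᵗ hb x) Y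
      write v x h

    retrieveᵗ : (Y rest : List (Fin n)) → Timed (State m n)
    retrieveᵗ Y rest = do
      hs′ ← foldlᵗ dropStackᵗ hs Y
      rb′ ← foldlᵗ (dropTargetᵗ Y) rb rest
      v   ← copyᵗ hb
      hb′ ← foldlᵗ (dropTargetᵗ Y) v rest
      return (mkState hs′ hb′ rb′ rest)

  module _ (low : Vector ℕ m) (choose : Chooser n) where

    -- The first argument bounds the number of cycles; n is enough.
    cyclesᵗ : ℕ → State m n → Timed (List (Plan n))
    beginᵗ  : ℕ → State m n → (remaining : List (Fin n)) → Timed (List (Plan n))
    cycleᵗ  : ℕ → State m n → (accessible : List (Fin n)) → Timed (List (Plan n))

    cyclesᵗ zero       st = return []
    cyclesᵗ (suc fuel) st = beginᵗ fuel st (State.remaining st)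

    beginᵗ fuel st                        []       = return []
    beginᵗ fuel st@(mkState hs hb rb rem) (x ∷ xs) = do
      b  ← highestᵗ low hs hb rb x xs
      bs ← accessibleInᵗ low hs hb rb b rem
      cycleᵗ fuel st bs

    -- All targets in `accessible` lie in one stack, so `highestᵗ` finds the
    -- topmost.
    cycleᵗ fuel st                     []       = return []
    cycleᵗ fuel (mkState hs hb rb rem) (x ∷ xs) = do
      b′         ← highestᵗ low hs hb rb x xs
      cand       ← removeᵗ low hs hb rb b′ rem
      (Y , rest) ← growᵗ low hs hb rb n choose b′ cand [ b′ ]
      bs         ← sortᵗ low hs hb rb Y
      base       ← hb ! b′
      st′        ← retrieveᵗ low hs hb rb bs rest
      plans      ← cyclesᵗ fuel st′
      tick
      return (mkPlan base bs ∷ plans)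

  algorithm2 : (low : Vector ℕ m) → Chooser n → Timed (List (Plan n))
  algorithm2 low choose = do
    rb ← tabulateᵗ (λ b → countᵗ (belowᵗ height b) (allFin n))
    hb ← copyᵗ height
    cyclesᵗ low choose n (mkState stackHeight hb rb (allFin n))

-- Draw a batch in the grid of stacks and current heights, and let H be the
-- height of its first target.  Whichever anchors are used, C1, C2 and C3
-- preserve the following: above H the batch is a staircase, and below H it
-- consists of rows that reach to the entry side (see `Shape`).  Hence between
-- a target of the batch and the clearance level of a stack at or before its
-- own, every position is filled by the batch, and retrieving from top to bottom
-- and from left to right makes each target accessible in its turn.
--
-- A cycle always finds a first target: h(b) − R(b) never changes, so by
-- feasibility the lowest remaining target of any stack is accessible, and
-- retrieving from the stack of the highest, rightmost target preserves
-- feasibility because all targets further right are strictly lower.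
--
-- A cycle retrieving k targets filters the candidates k times, at cost O(n) per
-- candidate.  It costs O(n²k) in total, and the k add up to n.

module Submission where

open import Defs
open import Data.Bool.Base using (Bool; true; false; T; if_then_else_)
open import Data.Bool.Properties using (T?)
open import Data.Fin.Base using (Fin; zero; suc; toℕ)
import Data.Fin.Base as Fin
import Data.Fin.Properties as Fin
open import Data.List.Base
  using (List; []; _∷_; [_]; _++_; length; filter; foldl; foldr; map; concatMap; allFin; lookup)
open import Data.List.Membership.Propositional using (_∈_; _∉_)
open import Data.List.Membership.Propositional.Properties
  using (∈-++⁺ˡ; ∈-++⁺ʳ; ∈-++⁻; ∈-filter⁺; ∈-filter⁻; ∈-lookup; ∈-allFin)
open import Data.List.Membership.Propositional.Properties.WithK using (unique∧set⇒bag)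
open import Data.List.Properties
  using (++-identityʳ; ++-assoc; length-++; length-tabulate; length-filter;
         filter-++; filter-accept; filter-reject)
open import Data.List.Relation.Binary.BagAndSetEquality using (∼bag⇒↭)
open import Data.List.Relation.Binary.Permutation.Propositional
  using (_↭_; ↭-refl; ↭-sym; ↭-trans; ↭-prep; ↭-swap; ↭-reflexive; ↭⇒↭ₛ; module PermutationReasoning)
open import Data.List.Relation.Binary.Permutation.Propositional.Properties
  using (filter-↭; ↭-length; ++⁺ˡ; ++⁺ʳ; ++-comm; ∈-resp-↭; shift)
open import Data.List.Relation.Binary.Permutation.Setoid.Properties using (Unique-resp-↭)
open import Data.List.Relation.Binary.Pointwise using (Pointwise; []; _∷_)
open import Data.List.Relation.Unary.All as All using (All; []; _∷_)
open import Data.List.Relation.Unary.AllPairs using (AllPairs; []; _∷_)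
open import Data.List.Relation.Unary.Any using (here; there)
open import Data.List.Relation.Unary.Unique.Propositional using (Unique)
open import Data.List.Relation.Unary.Unique.Propositional.Properties using (allFin⁺; filter⁺)
open import Data.Nat.Base hiding (_!)
open import Data.Nat.Properties
open import Data.Nat.Tactic.RingSolver using (solve-∀)
open import Data.Product.Base using (_×_; _,_; proj₁; proj₂; ∃-syntax)
open import Data.Sum.Base using (_⊎_; inj₁; inj₂; [_,_]′)
open import Data.Unit.Base using (tt)
open import Data.Vec.Functional using (Vector; tail)
open import Data.Vec.Functional.Properties using (updateAt-updates; updateAt-minimal)
open import Function.Base using (_∘_; id; case_of_)
open import Function.Bundles using (mk⇔)
open import Level using (Level)
open import Relation.Binary.Definitions using (tri<; tri≈; tri>)
open import Relation.Binary.PropositionalEquality hiding ([_])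
open import Relation.Nullary using (¬_; Dec; yes; no; does; contradiction; Reflects; ofʸ; ofⁿ)
open import Relation.Nullary.Decidable using (_×-dec_; ¬?; dec-true; dec-false)
open import Relation.Nullary.Reflects using (fromEquivalence; ¬-reflects)
open import Relation.Unary using (Pred; Decidable)

private variable
  ℓ₁ ℓ₂ ℓ₃ : Level
  A B : Set
  P Q : Set ℓ₁

-- Counting

count : {P : Pred A ℓ₁} → Decidable P → List A → ℕ
count P? xs = length (filter P? xs)

module _ {P : Pred A ℓ₁} (P? : Decidable P) where

  count-↭ : ∀ {xs ys} → xs ↭ ys → count P? xs ≡ count P? ys
  count-↭ xs↭ys = ↭-length (filter-↭ P? xs↭ys)

  count-++ : ∀ xs ys → count P? (xs ++ ys) ≡ count P? xs + count P? ys
  count-++ xs ys = trans (cong length (filter-++ P? xs ys)) (length-++ (filter P? xs))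

  count-yes : ∀ {x xs} → P x → count P? (x ∷ xs) ≡ suc (count P? xs)
  count-yes px = cong length (filter-accept P? px)

  count-no : ∀ {x xs} → ¬ P x → count P? (x ∷ xs) ≡ count P? xs
  count-no ¬px = cong length (filter-reject P? ¬px)

  count≡0 : ∀ xs → (∀ {x} → x ∈ xs → ¬ P x) → count P? xs ≡ 0
  count≡0 []       ¬p = refl
  count≡0 (x ∷ xs) ¬p = trans (count-no (¬p (here refl))) (count≡0 xs (¬p ∘ there))

  count>0 : ∀ {x xs} → x ∈ xs → P x → 0 < count P? xs
  count>0 {xs = _ ∷ xs} (here refl) px = ≤-trans (s≤s z≤n) (≤-reflexive (sym (count-yes px)))
  count>0 {xs = y ∷ xs} (there x∈xs) px with P? y
  ... | yes _ = s≤s z≤n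
  ... | no  _ = count>0 x∈xs px

  count>0⁻ : ∀ xs → 0 < count P? xs → ∃[ x ] x ∈ xs × P x
  count>0⁻ (x ∷ xs) 0<c with P? x
  ... | yes px = x , here refl , px
  ... | no  _  with y , y∈ , py ← count>0⁻ xs 0<c = y , there y∈ , py

  count≤1 : ∀ {xs} → Unique xs → (∀ {x y} → x ∈ xs → y ∈ xs → P x → P y → x ≡ y) →
            count P? xs ≤ 1
  count≤1 {[]}     []        _  = z≤n
  count≤1 {x ∷ xs} (x∉ ∷ xs!) eq with P? x
  ... | no  _  = count≤1 xs! (λ y∈ z∈ → eq (there y∈) (there z∈))
  ... | yes px = s≤s (≤-reflexive (count≡0 xs λ y∈ py →
                   All.lookup x∉ y∈ (eq (here refl) (there y∈) px py)))

module _ {P : Pred A ℓ₁} {Q : Pred A ℓ₂} (P? : Decidable P) (Q? : Decidable Q) where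

  count-mono : ∀ xs → (∀ {x} → x ∈ xs → P x → Q x) → count P? xs ≤ count Q? xs
  count-mono []       f = z≤n
  count-mono (x ∷ xs) f with P? x | Q? x
  ... | yes px | yes _  = s≤s (count-mono xs (f ∘ there))
  ... | yes px | no ¬qx = contradiction (f (here refl) px) ¬qx
  ... | no  _  | yes _  = m≤n⇒m≤1+n (count-mono xs (f ∘ there))
  ... | no  _  | no  _  = count-mono xs (f ∘ there)

count-cong : {P : Pred A ℓ₁} {Q : Pred A ℓ₂} (P? : Decidable P) (Q? : Decidable Q) → ∀ xs →
             (∀ {x} → x ∈ xs → P x → Q x) → (∀ {x} → x ∈ xs → Q x → P x) →
             count P? xs ≡ count Q? xs
count-cong P? Q? xs f g = ≤-antisym (count-mono P? Q? xs f) (count-mono Q? P? xs g)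

count-⊎ : {P : Pred A ℓ₁} {Q : Pred A ℓ₂} {R : Pred A ℓ₃}
          (P? : Decidable P) (Q? : Decidable Q) (R? : Decidable R) → ∀ xs →
          (∀ {x} → x ∈ xs → P x → Q x ⊎ R x) → (∀ {x} → x ∈ xs → Q x → P x) →
          (∀ {x} → x ∈ xs → R x → P x) → (∀ {x} → x ∈ xs → Q x → ¬ R x) →
          count P? xs ≡ count Q? xs + count R? xs
count-⊎ P? Q? R? []       _ _ _ _ = refl
count-⊎ P? Q? R? (x ∷ xs) split q⇒p r⇒p disj
  with ih ← count-⊎ P? Q? R? xs (split ∘ there) (q⇒p ∘ there) (r⇒p ∘ there) (disj ∘ there)
  with P? x | Q? x | R? x
... | _      | yes qx | yes rx = contradiction rx (disj (here refl) qx)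
... | no ¬px | yes qx | _      = contradiction (q⇒p (here refl) qx) ¬px
... | no ¬px | _      | yes rx = contradiction (r⇒p (here refl) rx) ¬px
... | no _   | no _   | no _   = ih
... | yes _  | yes _  | no _   = cong suc ih
... | yes _  | no _   | yes _  = trans (cong suc ih) (sym (+-suc _ _))
... | yes px | no ¬qx | no ¬rx = contradiction (split (here refl) px) [ ¬qx , ¬rx ]′

unique∧set⇒↭ : {xs ys : List A} → Unique xs → Unique ys →
               (∀ {x} → x ∈ xs → x ∈ ys) → (∀ {x} → x ∈ ys → x ∈ xs) → xs ↭ ys
unique∧set⇒↭ xs! ys! f g = ∼bag⇒↭ (unique∧set⇒bag xs! ys! (mk⇔ f g))

module Pigeonhole {P : Pred A ℓ₁} (P? : Decidable P) (f : A → ℕ) {xs : List A} (xs! : Unique xs)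
  (f-injective : ∀ {x y} → x ∈ xs → y ∈ xs → P x → P y → f x ≡ f y → x ≡ y) where

  count< count≈ : ℕ → ℕ
  count< n = count (λ x → P? x ×-dec (f x <? n)) xs
  count≈ n = count (λ x → P? x ×-dec (f x ≟ n)) xs

  count<-suc : ∀ n → count< (suc n) ≡ count≈ n + count< n
  count<-suc n = count-⊎ _ _ _ xs
    (λ { _ (px , s≤s fx≤n) →
         [ (λ fx<n → inj₂ (px , fx<n)) , (λ fx≡n → inj₁ (px , fx≡n)) ]′ (m≤n⇒m<n∨m≡n fx≤n) })
    (λ { _ (px , refl) → px , ≤-refl })
    (λ { _ (px , fx<n) → px , m≤n⇒m≤1+n fx<n })
    (λ { _ (_ , refl) (_ , n<n) → <-irrefl refl n<n })

  count≈≤1 : ∀ n → count≈ n ≤ 1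
  count≈≤1 n = count≤1 _ xs! λ x∈ y∈ (px , fx≡n) (py , fy≡n) →
    f-injective x∈ y∈ px py (trans fx≡n (sym fy≡n))

  count<-+ : ∀ k n → count< (k + n) ≤ k + count< n
  count<-+ zero    n = ≤-refl
  count<-+ (suc k) n = begin
    count< (suc (k + n))             ≡⟨ count<-suc (k + n) ⟩
    count≈ (k + n) + count< (k + n)  ≤⟨ +-mono-≤ (count≈≤1 (k + n)) (count<-+ k n) ⟩
    suc (k + count< n)               ∎
    where open ≤-Reasoning

  count<-step : ∀ {l n} → l < n → (∀ {x} → x ∈ xs → P x → f x ≢ l) →
                l + count< n < n + count< l
  count<-step {l} {n} l<n free = begin-strict
    l + count< n                          ≡⟨ cong (λ k → l + count< k) (m∸n+n≡m l<n) ⟨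
    l + count< (n ∸ suc l + suc l)        ≤⟨ +-monoʳ-≤ l (count<-+ (n ∸ suc l) (suc l)) ⟩
    l + (n ∸ suc l + count< (suc l))      ≡⟨ cong (λ k → l + (n ∸ suc l + k)) same ⟩
    l + (n ∸ suc l + count< l)            <⟨ ≤-refl ⟩
    suc l + (n ∸ suc l + count< l)        ≡⟨ +-assoc (suc l) _ _ ⟨
    suc l + (n ∸ suc l) + count< l        ≡⟨ cong (_+ count< l) (m+[n∸m]≡n l<n) ⟩
    n + count< l                          ∎
    where
    open ≤-Reasoning
    same : count< (suc l) ≡ count< l
    same = trans (count<-suc l)
      (cong (_+ count< l) (count≡0 _ xs λ x∈ (px , fx≡l) → free x∈ px fx≡l))

  count<-≤ : ∀ n → count< n ≤ n
  count<-≤ n = begin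
    count< n        ≡⟨ cong count< (+-identityʳ n) ⟨
    count< (n + 0)  ≤⟨ count<-+ n 0 ⟩
    n + count< 0    ≡⟨ cong (n +_) (count≡0 _ xs λ { _ (_ , ()) }) ⟩
    n + 0           ≡⟨ +-identityʳ n ⟩
    n               ∎
    where open ≤-Reasoning

  full⇒hit : ∀ n → count< n ≡ n → ∀ v → v < n → ∃[ x ] x ∈ xs × P x × f x ≡ v
  full⇒hit (suc n) eq v (s≤s v≤n) with m≤n⇒m<n∨m≡n v≤n
  ... | inj₁ v<n  = full⇒hit n (≤-antisym (count<-≤ n) (s≤s⁻¹ n<1+count<)) v v<n
    where
    n<1+count< : suc n ≤ suc (count< n)
    n<1+count< = ≤-trans (≤-reflexive (trans (sym eq) (count<-suc n))) (+-monoˡ-≤ _ (count≈≤1 n))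
  ... | inj₂ refl = count>0⁻ _ xs (+-cancelʳ-≤ n 1 (count≈ n)
    (≤-trans (≤-reflexive (trans (sym eq) (count<-suc n))) (+-monoʳ-≤ (count≈ n) (count<-≤ n))))

  hit⇒full : ∀ n → (∀ v → v < n → ∃[ x ] x ∈ xs × P x × f x ≡ v) → count< n ≡ n
  hit⇒full zero    _   = count≡0 _ xs λ { _ (_ , ()) }
  hit⇒full (suc n) hit with x , x∈ , px , fx≡n ← hit n ≤-refl = trans (count<-suc n)
    (cong₂ _+_ (≤-antisym (count≈≤1 n) (count>0 _ x∈ (px , fx≡n)))
               (hit⇒full n λ v v<n → hit v (m≤n⇒m≤1+n v<n)))

-- Values of timed programs

reflects-map : ∀ {b} → (P → Q) → (Q → P) → Reflects P b → Reflects Q b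
reflects-map f g (ofʸ x)  = ofʸ (f x)
reflects-map f g (ofⁿ ¬x) = ofⁿ (¬x ∘ g)

reflects-T : ∀ {b} → Reflects P b → T b → P
reflects-T (ofʸ x) _ = x

T-reflected : ∀ {b} → Reflects P b → P → T b
T-reflected (ofʸ _)  _ = tt
T-reflected (ofⁿ ¬x) x = contradiction x ¬x

≡ᵇ-reflects-≡ : ∀ i j → Reflects (i ≡ j) (i ≡ᵇ j)
≡ᵇ-reflects-≡ i j = fromEquivalence (≡ᵇ⇒≡ i j) (≡⇒≡ᵇ i j)

infixr 3 _∧ʳ_
infixr 2 _∨ʳ_

_∧ʳ_ : ∀ {b x} → Reflects P b → Reflects Q (value x) →
       Reflects (P × Q) (value (if b then x else return false))
ofʸ x  ∧ʳ r = reflects-map (x ,_) proj₂ r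
ofⁿ ¬x ∧ʳ _ = ofⁿ (¬x ∘ proj₁)

_∨ʳ_ : ∀ {b x} → Reflects P b → Reflects Q (value x) →
       Reflects (P ⊎ Q) (value (if b then return true else x))
ofʸ x  ∨ʳ _ = ofʸ (inj₁ x)
ofⁿ ¬x ∨ʳ r = reflects-map inj₂ [ (λ x → contradiction x ¬x) , id ]′ r

module _ {P : Pred A ℓ₁} {t : A → Timed Bool} where

  allᵗ-reflects : ∀ xs → (∀ {x} → x ∈ xs → Reflects (P x) (value (t x))) →
                  Reflects (∀ x → x ∈ xs → P x) (value (allᵗ t xs))
  allᵗ-reflects []       r = ofʸ λ _ ()
  allᵗ-reflects (x ∷ xs) r = reflects-map
    (λ (px , pxs) _ → λ { (here refl) → px ; (there x∈) → pxs _ x∈ })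
    (λ f → f x (here refl) , λ y → f y ∘ there)
    (r (here refl) ∧ʳ allᵗ-reflects xs (r ∘ there))

  anyᵗ-reflects : ∀ xs → (∀ {x} → x ∈ xs → Reflects (P x) (value (t x))) →
                  Reflects (∃[ x ] x ∈ xs × P x) (value (anyᵗ t xs))
  anyᵗ-reflects []       r = ofⁿ λ ()
  anyᵗ-reflects (x ∷ xs) r = reflects-map
    [ (λ px → x , here refl , px) , (λ (y , y∈ , py) → y , there y∈ , py) ]′
    (λ { (_ , here refl , px) → inj₁ px ; (y , there y∈ , py) → inj₂ (y , y∈ , py) })
    (r (here refl) ∨ʳ anyᵗ-reflects xs (r ∘ there))

  countᵗ-value : (P? : Decidable P) → ∀ xs → (∀ {x} → x ∈ xs → Reflects (P x) (value (t x))) →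
                 value (countᵗ t xs) ≡ count P? xs
  countᵗ-value P? []       r = refl
  countᵗ-value P? (x ∷ xs) r with ih ← countᵗ-value P? xs (r ∘ there)
    with value (t x) | r (here refl) | P? x
  ... | true  | ofʸ px  | no ¬px = contradiction px ¬px
  ... | false | ofⁿ ¬px | yes px = contradiction px ¬px
  ... | true  | _       | yes _  = cong suc ih
  ... | false | _       | no _   = ih

module _ (t : A → Timed Bool) where

  filterᵗ-value : ∀ xs → value (filterᵗ t xs) ≡ filter (T? ∘ value ∘ t) xs
  filterᵗ-value []       = refl
  filterᵗ-value (x ∷ xs) with ih ← filterᵗ-value xs with value (t x)
  ... | true  = cong (x ∷_) ih
  ... | false = ih

  ∈-filterᵗ⁺ : ∀ {P : Pred A ℓ₁} {x xs} → (∀ {x} → x ∈ xs → Reflects (P x) (value (t x))) →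
               x ∈ xs → P x → x ∈ value (filterᵗ t xs)
  ∈-filterᵗ⁺ {xs = xs} r x∈ px = subst (_ ∈_) (sym (filterᵗ-value xs))
    (∈-filter⁺ (T? ∘ value ∘ t) x∈ (T-reflected (r x∈) px))

  ∈-filterᵗ⁻ : ∀ {P : Pred A ℓ₁} {x} xs → (∀ {x} → x ∈ xs → Reflects (P x) (value (t x))) →
               x ∈ value (filterᵗ t xs) → x ∈ xs × P x
  ∈-filterᵗ⁻ xs r x∈ with ∈-filter⁻ (T? ∘ value ∘ t) {xs = xs} (subst (_ ∈_) (filterᵗ-value xs) x∈)
  ... | x∈xs , tx = x∈xs , reflects-T (r x∈xs) tx

  filterᵗ-unique : ∀ {xs} → Unique xs → Unique (value (filterᵗ t xs))
  filterᵗ-unique {xs} xs! = subst Unique (sym (filterᵗ-value xs)) (filter⁺ (T? ∘ value ∘ t) xs!)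

  filterᵗ-length : ∀ xs → length (value (filterᵗ t xs)) ≤ length xs
  filterᵗ-length xs = subst (λ ys → length ys ≤ length xs) (sym (filterᵗ-value xs))
    (length-filter (T? ∘ value ∘ t) xs)

tabulateᵗ-value : ∀ {k} (f : Fin k → Timed A) i → value (tabulateᵗ f) i ≡ value (f i)
tabulateᵗ-value f zero    = refl
tabulateᵗ-value f (suc i) = tabulateᵗ-value (f ∘ suc) i

scanMin-glb : ∀ {k} acc (h : Vector ℕ k) {t b} → b ≤ acc → (∀ t′ → t′ Fin.≤ t → b ≤ h t′) →
              b ≤ value (scanMin acc h) t
scanMin-glb acc h {zero}  b≤ b≤h = ⊓-glb b≤ (b≤h zero z≤n)
scanMin-glb acc h {suc t} b≤ b≤h =
  scanMin-glb (acc ⊓ h zero) (tail h) (⊓-glb b≤ (b≤h zero z≤n)) (λ t′ t′≤t → b≤h (suc t′) (s≤s t′≤t))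

scanMin-≤acc : ∀ {k} acc (h : Vector ℕ k) t → value (scanMin acc h) t ≤ acc
scanMin-≤acc acc h zero    = m⊓n≤m acc _
scanMin-≤acc acc h (suc t) = ≤-trans (scanMin-≤acc (acc ⊓ h zero) (tail h) t) (m⊓n≤m acc _)

scanMin-≤ : ∀ {k} acc (h : Vector ℕ k) {t t′} → t′ Fin.≤ t → value (scanMin acc h) t ≤ h t′
scanMin-≤ acc h {zero}  {zero}   _          = m⊓n≤n acc _
scanMin-≤ acc h {suc t} {zero}   _          = ≤-trans (scanMin-≤acc (acc ⊓ h zero) (tail h) t) (m⊓n≤n acc _)
scanMin-≤ acc h {suc t} {suc t′} (s≤s t′≤t) = scanMin-≤ (acc ⊓ h zero) (tail h) t′≤t

prefixMinima-glb : ∀ {k} (h : Vector ℕ k) {t b} → (∀ t′ → t′ Fin.≤ t → b ≤ h t′) →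
                   b ≤ value (prefixMinima h) t
prefixMinima-glb {suc k} h {t} b≤h = scanMin-glb (h zero) h {t} (b≤h zero z≤n) b≤h

prefixMinima-≤ : ∀ {k} (h : Vector ℕ k) {t t′} → t′ Fin.≤ t → value (prefixMinima h) t ≤ h t′
prefixMinima-≤ {suc k} h = scanMin-≤ (h zero) h

-- Costs of timed programs

∧ᵗ-cost : ∀ {c d} x y → cost x ≤ c → cost y ≤ d → cost (x ∧ᵗ y) ≤ c + suc d
∧ᵗ-cost (true  after _) y x≤ y≤ = +-mono-≤ x≤ (s≤s y≤)
∧ᵗ-cost (false after _) y x≤ y≤ = +-mono-≤ x≤ (s≤s z≤n)

∨ᵗ-cost : ∀ {c d} x y → cost x ≤ c → cost y ≤ d → cost (x ∨ᵗ y) ≤ c + suc d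
∨ᵗ-cost (true  after _) y x≤ y≤ = +-mono-≤ x≤ (s≤s z≤n)
∨ᵗ-cost (false after _) y x≤ y≤ = +-mono-≤ x≤ (s≤s y≤)

module _ {t : A → Timed Bool} {c : ℕ} where

  allᵗ-cost : ∀ xs → (∀ x → cost (t x) ≤ c) → cost (allᵗ t xs) ≤ 1 + length xs * (2 + c)
  allᵗ-cost []       t≤ = ≤-refl
  allᵗ-cost (x ∷ xs) t≤ = begin
    cost (t x ∧ᵗ allᵗ t xs)               ≤⟨ ∧ᵗ-cost (t x) (allᵗ t xs) (t≤ x) (allᵗ-cost xs t≤) ⟩
    c + suc (1 + length xs * (2 + c))     ≡⟨ +-suc c _ ⟩
    suc (c + suc (length xs * (2 + c)))   ≡⟨ cong suc (+-suc c _) ⟩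
    2 + c + length xs * (2 + c)           ≤⟨ n≤1+n _ ⟩
    1 + (2 + c + length xs * (2 + c))     ∎
    where open ≤-Reasoning

  anyᵗ-cost : ∀ xs → (∀ x → cost (t x) ≤ c) → cost (anyᵗ t xs) ≤ 1 + length xs * (2 + c)
  anyᵗ-cost []       t≤ = ≤-refl
  anyᵗ-cost (x ∷ xs) t≤ = begin
    cost (t x ∨ᵗ anyᵗ t xs)               ≤⟨ ∨ᵗ-cost (t x) (anyᵗ t xs) (t≤ x) (anyᵗ-cost xs t≤) ⟩
    c + suc (1 + length xs * (2 + c))     ≡⟨ +-suc c _ ⟩
    suc (c + suc (length xs * (2 + c)))   ≡⟨ cong suc (+-suc c _) ⟩
    2 + c + length xs * (2 + c)           ≤⟨ n≤1+n _ ⟩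
    1 + (2 + c + length xs * (2 + c))     ∎
    where open ≤-Reasoning

  filterᵗ-cost : ∀ xs → (∀ x → cost (t x) ≤ c) → cost (filterᵗ t xs) ≤ 1 + length xs * (2 + c)
  filterᵗ-cost []       t≤ = ≤-refl
  filterᵗ-cost (x ∷ xs) t≤ = begin
    1 + (cost (t x) + (cost (filterᵗ t xs) + 0))
      ≡⟨ cong (λ k → 1 + (cost (t x) + k)) (+-identityʳ _) ⟩
    1 + (cost (t x) + cost (filterᵗ t xs))
      ≤⟨ s≤s (+-mono-≤ (t≤ x) (filterᵗ-cost xs t≤)) ⟩
    1 + (c + (1 + length xs * (2 + c)))
      ≡⟨ cong suc (+-suc c _) ⟩
    2 + c + length xs * (2 + c)
      ≤⟨ n≤1+n _ ⟩
    1 + (2 + c + length xs * (2 + c)) ∎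
    where open ≤-Reasoning

  countᵗ-cost : ∀ xs → (∀ x → cost (t x) ≤ c) → cost (countᵗ t xs) ≤ 1 + length xs * (2 + c)
  countᵗ-cost []       t≤ = ≤-refl
  countᵗ-cost (x ∷ xs) t≤ = begin
    1 + (cost (t x) + (cost (countᵗ t xs) + step))
      ≤⟨ s≤s (+-mono-≤ (t≤ x) (+-mono-≤ (countᵗ-cost xs t≤) (step≤1 (value (t x))))) ⟩
    1 + (c + (1 + length xs * (2 + c) + 1))
      ≡⟨ cong (λ k → 1 + (c + k)) (+-comm _ 1) ⟩
    1 + (c + (2 + length xs * (2 + c)))
      ≡⟨ cong suc (trans (+-suc c _) (cong suc (+-suc c _))) ⟩
    1 + (2 + c + length xs * (2 + c)) ∎
    where
    open ≤-Reasoning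
    n′ : ℕ
    n′ = value (countᵗ t xs)
    step : ℕ
    step = cost (if value (t x) then sucᵗ (return n′) else return n′)
    step≤1 : ∀ b → cost (if b then sucᵗ (return n′) else return n′) ≤ 1
    step≤1 true  = ≤-refl
    step≤1 false = z≤n

foldlᵗ-cost : ∀ {f : A → B → Timed A} {c} a xs → (∀ a x → cost (f a x) ≤ c) →
              cost (foldlᵗ f a xs) ≤ 1 + length xs * (2 + c)
foldlᵗ-cost a []       f≤ = ≤-refl
foldlᵗ-cost {f = f} {c} a (x ∷ xs) f≤ = begin
  1 + (cost (f a x) + cost (foldlᵗ f (value (f a x)) xs))
    ≤⟨ s≤s (+-mono-≤ (f≤ a x) (foldlᵗ-cost _ xs f≤)) ⟩
  1 + (c + (1 + length xs * (2 + c)))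
    ≡⟨ cong suc (+-suc c _) ⟩
  2 + c + length xs * (2 + c)
    ≤⟨ n≤1+n _ ⟩
  1 + (2 + c + length xs * (2 + c)) ∎
  where open ≤-Reasoning

tabulateᵗ-cost : ∀ {k c} (f : Fin k → Timed A) → (∀ i → cost (f i) ≤ c) →
                 cost (tabulateᵗ f) ≤ k * (1 + c)
tabulateᵗ-cost {k = zero}  f f≤ = z≤n
tabulateᵗ-cost {k = suc k} {c} f f≤ = s≤s (+-mono-≤ (f≤ zero)
  (≤-trans (≤-reflexive (+-identityʳ _)) (tabulateᵗ-cost (f ∘ suc) (f≤ ∘ suc))))

scanMin-cost : ∀ {k} acc (h : Vector ℕ k) → cost (scanMin acc h) ≤ 3 * k
scanMin-cost {zero}  acc h = z≤n
scanMin-cost {suc k} acc h = begin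
  2 + (cost (scanMin _ (tail h)) + 1)  ≤⟨ +-monoʳ-≤ 2 (+-monoˡ-≤ 1 (scanMin-cost _ (tail h))) ⟩
  2 + (3 * k + 1)                      ≡⟨ cong (2 +_) (+-comm (3 * k) 1) ⟩
  3 + 3 * k                            ≡⟨ *-suc 3 k ⟨
  3 * suc k                            ∎
  where open ≤-Reasoning

prefixMinima-cost : ∀ {k} (h : Vector ℕ k) → cost (prefixMinima h) ≤ 4 * k
prefixMinima-cost {zero}  h = z≤n
prefixMinima-cost {suc k} h = +-mono-≤ {1} {suc k} (s≤s z≤n) (scanMin-cost (h zero) h)

-- Heights of the remaining targets and the shape of a batch

∸-mono-<-+ : ∀ {a b c d} → c ≤ a → a + d < b + c → a ∸ c < b ∸ d
∸-mono-<-+ {a} {b} {c} {d} c≤a lt = m+n≤o⇒m≤o∸n (suc (a ∸ c)) (+-cancelʳ-≤ c _ _ (begin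
  suc (a ∸ c + d) + c  ≡⟨ cong suc (+-assoc (a ∸ c) d c) ⟩
  suc (a ∸ c + (d + c)) ≡⟨ cong (λ k → suc (a ∸ c + k)) (+-comm d c) ⟩
  suc (a ∸ c + (c + d)) ≡⟨ cong suc (+-assoc (a ∸ c) c d) ⟨
  suc (a ∸ c + c + d)  ≡⟨ cong (λ k → suc (k + d)) (m∸n+n≡m c≤a) ⟩
  suc (a + d)          ≤⟨ lt ⟩
  b + c                ∎))
  where open ≤-Reasoning

∸-+-swap : ∀ a b c → a ∸ (b + c) ≡ a ∸ c ∸ b
∸-+-swap a b c = trans (cong (a ∸_) (+-comm b c)) (sym (∸-+-assoc a c b))

Unique-↭ : {xs ys : List A} → xs ↭ ys → Unique xs → Unique ys
Unique-↭ xs↭ys = Unique-resp-↭ (setoid _) (↭⇒↭ₛ xs↭ys)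

Unique-++⁻ : ∀ (xs : List A) {ys} → Unique (xs ++ ys) →
             Unique xs × Unique ys × (∀ {x} → x ∈ xs → x ∉ ys)
Unique-++⁻ []       ys! = [] , ys! , λ ()
Unique-++⁻ (x ∷ xs) (x∉ ∷ u) with xs! , ys! , disj ← Unique-++⁻ xs u =
  All.tabulate (λ y∈ → All.lookup x∉ (∈-++⁺ˡ y∈)) ∷ xs! , ys! ,
  λ { (here refl) x∈ys → All.lookup x∉ (∈-++⁺ʳ xs x∈ys) refl ; (there x∈) → disj x∈ }

∉-∷ : {x : A} {xs : List A} → x ∉ xs → All (x ≢_) xs
∉-∷ x∉ = All.tabulate λ { y∈ refl → x∉ y∈ }

module _ {m n : ℕ} (I : Instance m n) where
  open Instance I

  open import Data.List.Membership.DecPropositional (Fin._≟_ {n}) using (_∈?_)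

  inStack? : ∀ t y → Dec (stack y ≡ t)
  inStack? t y = stack y Fin.≟ t

  module _ {D : List (Fin n)} (D! : Unique D) where

    private module PH t = Pigeonhole (inStack? t) height D!
              (λ _ _ s≡t s′≡t → distinct (trans s≡t (sym s′≡t)))

    heightᴰ-mono-< : ∀ {b y} → y ∉ D → stack y ≡ stack b → height y < height b →
                     heightᴰ I D y < heightᴰ I D b
    heightᴰ-mono-< {b} {y} y∉D s≡ y<b rewrite sym s≡ =
      ∸-mono-<-+ (PH.count<-≤ (stack y) (height y))
        (PH.count<-step (stack y) y<b λ x∈D s≡′ h≡ → y∉D (subst (_∈ D) (distinct s≡′ h≡) x∈D))

    heightᴰ<stackHeightᴰ : ∀ {b} → b ∉ D → heightᴰ I D b < stackHeightᴰ I D (stack b)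
    heightᴰ<stackHeightᴰ {b} b∉D = ∸-mono-<-+ (PH.count<-≤ t (height b))
      (subst (λ k → height b + k < stackHeight t + PH.count< t (height b)) all-below
        (PH.count<-step t (height< b) λ x∈D s≡ h≡ → b∉D (subst (_∈ D) (distinct s≡ h≡) x∈D)))
      where
      t : Fin m
      t = stack b
      all-below : PH.count< t (stackHeight t) ≡ count (inStack? t) D
      all-below = count-cong _ _ D (λ _ → proj₁)
        (λ {x} _ s≡ → s≡ , subst (λ t → height x < stackHeight t) s≡ (height< x))

    heightᴰ-cancel-< : ∀ {b y} → b ∉ D → stack y ≡ stack b → heightᴰ I D y < heightᴰ I D b →
                       height y < height b
    heightᴰ-cancel-< {b} {y} b∉D s≡ lt with <-cmp (height y) (height b)
    ... | tri< y<b _ _ = y<b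
    ... | tri≈ _ y≡b _ with refl ← distinct s≡ y≡b = contradiction lt (<-irrefl refl)
    ... | tri> _ _ b<y = contradiction (heightᴰ-mono-< b∉D (sym s≡) b<y) (<-asym lt)

    heightᴰ-injective : ∀ {b y} → b ∉ D → y ∉ D → stack y ≡ stack b →
                        heightᴰ I D y ≡ heightᴰ I D b → y ≡ b
    heightᴰ-injective {b} {y} b∉D y∉D s≡ h≡ with <-cmp (height y) (height b)
    ... | tri< y<b _ _ = contradiction h≡ (<⇒≢ (heightᴰ-mono-< y∉D s≡ y<b))
    ... | tri≈ _ y≡b _ = distinct s≡ y≡b
    ... | tri> _ _ b<y = contradiction (sym h≡) (<⇒≢ (heightᴰ-mono-< b∉D (sym s≡) b<y))

    below-split : ∀ b → count (below? I b) D + Rᴰ I D b ≡ count (below? I b) (allFin n)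
    below-split b = sym (begin
      count (below? I b) (allFin n)
        ≡⟨ count-⊎ (below? I b) (λ y → below? I b y ×-dec (y ∈? D))
             (λ y → below? I b y ×-dec ¬? (y ∈? D)) (allFin n)
             (λ {y} _ p → case y ∈? D of λ { (yes q) → inj₁ (p , q) ; (no ¬q) → inj₂ (p , ¬q) })
             (λ _ → proj₁) (λ _ → proj₁) (λ _ (_ , q) (_ , ¬q) → ¬q q) ⟩
      count (λ y → below? I b y ×-dec (y ∈? D)) (allFin n) + Rᴰ I D b
        ≡⟨ cong (_+ Rᴰ I D b) (↭-length (unique∧set⇒↭
             (filter⁺ _ (allFin⁺ n)) (filter⁺ _ D!)
             (λ x∈ → let _ , p , x∈D = ∈-filter⁻ _ {xs = allFin n} x∈ in ∈-filter⁺ (below? I b) x∈D p)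
             (λ x∈ → let x∈D , p = ∈-filter⁻ (below? I b) {xs = D} x∈ in
                     ∈-filter⁺ _ (∈-allFin _) (p , x∈D)))) ⟩
      count (below? I b) D + Rᴰ I D b ∎)
      where open ≡-Reasoning

  heightᴰ-++ : ∀ Y D b → heightᴰ I (Y ++ D) b ≡ heightᴰ I D b ∸ count (below? I b) Y
  heightᴰ-++ Y D b = trans (cong (height b ∸_) (count-++ (below? I b) Y D))
    (∸-+-swap (height b) (count (below? I b) Y) (count (below? I b) D))

  stackHeightᴰ-++ : ∀ Y D t → stackHeightᴰ I (Y ++ D) t ≡ stackHeightᴰ I D t ∸ count (inStack? t) Y
  stackHeightᴰ-++ Y D t =
    trans (cong (stackHeight t ∸_) (count-++ (inStack? t) Y D))
    (∸-+-swap (stackHeight t) (count (inStack? t) Y) (count (inStack? t) D))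

  -- h(b) − R(b), which no retrieval changes.
  demand : Fin n → ℕ
  demand b = height b ∸ count (below? I b) (allFin n)

  demand-invariant : ∀ {D} → Unique D → ∀ b → heightᴰ I D b ∸ Rᴰ I D b ≡ demand b
  demand-invariant {D} D! b = trans (∸-+-assoc (height b) (count (below? I b) D) (Rᴰ I D b))
    (cong (height b ∸_) (below-split D! b))

  Supplied : List (Fin n) → Set
  Supplied D = ∀ b → b ∉ D → ∀ t → t Fin.< stack b → demand b ≤ stackHeightᴰ I D t

  Feasible⇒Supplied : ∀ {D} → Unique D → Feasible I D → Supplied D
  Feasible⇒Supplied {D} D! feas b b∉D t t<s =
    subst (_≤ stackHeightᴰ I D t) (demand-invariant D! b) (feas b b∉D t t<s)

  Supplied⇒Feasible : ∀ {D} → Unique D → Supplied D → Feasible I D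
  Supplied⇒Feasible {D} D! supp b b∉D t t<s =
    subst (_≤ stackHeightᴰ I D t) (sym (demand-invariant D! b)) (supp b b∉D t t<s)

  Reachable : List (Fin n) → Fin n → Set
  Reachable D b = ∀ t → t Fin.< stack b → heightᴰ I D b ≤ stackHeightᴰ I D t

  Accessible⇒Reachable : ∀ D {b} → Accessible I D b → Reachable D b
  Accessible⇒Reachable D (ℓ , ℓ≤ , _ , left) t t<s = ≤-trans (≤-reflexive (sym (left t t<s))) (ℓ≤ t)

  Reachable⇒Accessible : ∀ {D b} → Unique D → b ∉ D → Reachable D b → Accessible I D b
  Reachable⇒Accessible {D} {b} D! b∉D reach = ℓ , (λ t → m⊓n≤m _ _) , own , left
    where
    ℓ : Fin m → ℕ
    ℓ t = stackHeightᴰ I D t ⊓ (if does (t Fin.≟ stack b) then suc (heightᴰ I D b) else heightᴰ I D b)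
    own : ℓ (stack b) ≡ suc (heightᴰ I D b)
    own rewrite dec-true (stack b Fin.≟ stack b) refl = m≥n⇒m⊓n≡n (heightᴰ<stackHeightᴰ D! b∉D)
    left : ∀ t → t Fin.< stack b → ℓ t ≡ heightᴰ I D b
    left t t<s rewrite dec-false (t Fin.≟ stack b) (Fin.<⇒≢ t<s) = m≥n⇒m⊓n≡n (reach t t<s)

  -- The positions of a batch at and above the height of its first target b₀
  -- form a staircase; below, they form rows reaching to the entry side, each
  -- contained in the next except possibly at the height of b₀.
  record Shape (D : List (Fin n)) (b₀ : Fin n) (Y : List (Fin n)) : Set where
    field
      fresh     : Unique (Y ++ D)
      first∈    : b₀ ∈ Y
      bounded   : ∀ {y} → y ∈ Y → stack y Fin.≤ stack b₀
      reachable : ∀ {y} → y ∈ Y → Reachable D y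
      stairs    : ∀ {t t′ k} → Occupied I D Y t (suc k) → heightᴰ I D b₀ ≤ k → t′ Fin.≤ t →
                  Occupied I D Y t′ k
      rows      : ∀ {t t′ k} → Occupied I D Y t k → k < heightᴰ I D b₀ → t′ Fin.≤ t →
                  Occupied I D Y t′ k
      nested    : ∀ {t k} → Occupied I D Y t k → suc k < heightᴰ I D b₀ → Occupied I D Y t (suc k)

  shape-start : ∀ {D b₀} → Unique D → b₀ ∉ D → Reachable D b₀ → Shape D b₀ [ b₀ ]
  shape-start D! b₀∉D reach = record
    { fresh     = ∉-∷ b₀∉D ∷ D!
    ; first∈    = here refl
    ; bounded   = λ { (here refl) → ≤-refl }
    ; reachable = λ { (here refl) → reach }
    ; stairs    = λ { (_ , here refl , _ , h≡) h≤k →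
                      contradiction (≤-trans (≤-reflexive (sym h≡)) h≤k) (<-irrefl refl) }
    ; rows      = λ { (_ , here refl , _ , h≡) k<h → contradiction h≡ (<⇒≢ k<h ∘ sym) }
    ; nested    = λ { (_ , here refl , _ , h≡) k<h →
                      contradiction h≡ (<⇒≢ (<-trans (n<1+n _) k<h) ∘ sym) }
    }

  shape-extend : ∀ {D b₀ Y a b} → Shape D b₀ Y → Anchor I Y a → b ∉ D → b ∉ Y → Reachable D b →
                 stack b Fin.≤ stack a → C1 I D Y a b ⊎ C2 I D Y a b ⊎ C3 I D Y a b →
                 Shape D b₀ (b ∷ Y)
  shape-extend {D} {b₀} {Y} {a} {b} shape (a∈Y , rightmost) b∉D b∉Y reach b≤a ext = record
    { fresh     = ∉-∷ ([ b∉Y , b∉D ]′ ∘ ∈-++⁻ Y) ∷ fresh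
    ; first∈    = there first∈
    ; bounded   = λ { (here refl) → ≤-trans b≤a (bounded a∈Y) ; (there y∈) → bounded y∈ }
    ; reachable = λ { (here refl) → reach ; (there y∈) → reachable y∈ }
    ; stairs    = λ { (_ , here refl , refl , h≡) H≤k t′≤t → old (stairs′ ext h≡ H≤k t′≤t)
                    ; (y , there y∈ , p) H≤k t′≤t → old (stairs (y , y∈ , p) H≤k t′≤t) }
    ; rows      = λ { (_ , here refl , refl , refl) k<H t′≤t → rows′ ext k<H t′≤t
                    ; (y , there y∈ , p) k<H t′≤t → old (rows (y , y∈ , p) k<H t′≤t) }
    ; nested    = λ { (_ , here refl , refl , refl) k<H → old (nested′ ext k<H)
                    ; (y , there y∈ , p) k<H → old (nested (y , y∈ , p) k<H) }
    }
    where
    open Shape shape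
    h ha H : ℕ
    h  = heightᴰ I D b
    ha = heightᴰ I D a
    H  = heightᴰ I D b₀
    old : ∀ {t k} → Occupied I D Y t k → Occupied I D (b ∷ Y) t k
    old (y , y∈ , p) = y , there y∈ , p
    at-anchor : ∀ {k} → k ≡ ha → Occupied I D Y (stack a) k
    at-anchor refl = a , a∈Y , refl , refl
    Extends : Set
    Extends = C1 I D Y a b ⊎ C2 I D Y a b ⊎ C3 I D Y a b
    stairs′ : Extends → ∀ {t′ k} → h ≡ suc k → H ≤ k → t′ Fin.≤ stack b → Occupied I D Y t′ k
    stairs′ (inj₁ h≡ha) h≡ H≤k t′≤ = stairs (at-anchor (trans (sym h≡) h≡ha)) H≤k (≤-trans t′≤ b≤a)
    stairs′ (inj₂ (inj₁ (k , h≡′ , row))) h≡ H≤k t′≤ =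
      subst (Occupied I D Y _) (suc-injective (trans (sym h≡′) h≡)) (row _ t′≤)
    stairs′ (inj₂ (inj₂ (above , _))) {k = k} h≡ H≤k t′≤ =
      stairs (subst (Occupied I D Y (stack b)) h≡ here-too) H≤k t′≤
      where
      H≤h : H ≤ h
      H≤h = ≤-trans H≤k (≤-trans (n≤1+n k) (≤-reflexive (sym h≡)))
      here-too : Occupied I D Y (stack b) h
      here-too = [ (λ e → stairs (at-anchor e) H≤h b≤a) , (λ occ → stairs occ H≤h ≤-refl) ]′ above
    rows′ : Extends → ∀ {t′} → h < H → t′ Fin.≤ stack b → Occupied I D (b ∷ Y) t′ h
    rows′ (inj₁ h≡ha) h<H t′≤ = old (rows (at-anchor h≡ha) h<H (≤-trans t′≤ b≤a))
    rows′ (inj₂ (inj₁ (k , h≡ , row))) h<H t′≤ =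
      old (subst (Occupied I D Y _) (sym h≡) (nested (row _ t′≤) (subst (_< H) h≡ h<H)))
    rows′ (inj₂ (inj₂ (_ , beside))) {t′} h<H t′≤ with t′ Fin.≟ stack b | beside
    ... | yes refl | _                      = b , here refl , refl , refl
    ... | no t′≢s  | inj₁ s≡0               =
      contradiction (Fin.toℕ-injective (trans (n≤0⇒n≡0 (≤-trans t′≤ (≤-reflexive s≡0))) (sym s≡0))) t′≢s
    ... | no t′≢s  | inj₂ (t , 1+t≡s , occ) =
      old (rows occ h<H (s≤s⁻¹ (≤-trans (≤∧≢⇒< t′≤ (t′≢s ∘ Fin.toℕ-injective)) (≤-reflexive (sym 1+t≡s)))))
    nested′ : Extends → suc h < H → Occupied I D Y (stack b) (suc h)
    nested′ (inj₁ h≡ha) 1+h<H =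
      rows (nested (at-anchor h≡ha) 1+h<H) 1+h<H b≤a
    nested′ (inj₂ (inj₁ (k , h≡ , row))) 1+h<H =
      nested (subst (Occupied I D Y _) (sym h≡)
        (nested (row _ ≤-refl) (subst (_< H) h≡ (<-trans (n<1+n h) 1+h<H)))) 1+h<H
    nested′ (inj₂ (inj₂ (above , _))) 1+h<H =
      [ (λ e → rows (at-anchor e) 1+h<H b≤a) , id ]′ above

  batch-shape : ∀ {D Y} → Unique D → Batch I D Y → ∃[ b₀ ] Shape D b₀ Y
  batch-shape {D} D! (start {b′} (_ , _ , b′∉D , _ , acc , _)) =
    b′ , shape-start D! b′∉D (Accessible⇒Reachable D acc)
  batch-shape {D} D! (extend batch anchor legal) with b₀ , shape ← batch-shape D! batch =
    b₀ , shape-extend shape anchor notRetrieved notInBatch (Accessible⇒Reachable D accessible) left extends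
    where open Legal legal

-- Retrieving a batch

module _ {m n : ℕ} (I : Instance m n) where
  open Instance I

  Before : (Fin n → ℕ) → Fin n → Fin n → Set
  Before hb y z = hb z < hb y ⊎ hb z ≡ hb y × stack y Fin.≤ stack z

  Sorted : (Fin n → ℕ) → List (Fin n) → Set
  Sorted hb = AllPairs (Before hb)

  sorted-cong : ∀ {f g xs} → (∀ {x} → x ∈ xs → f x ≡ g x) → Sorted f xs → Sorted g xs
  sorted-cong f≡g []       = []
  sorted-cong f≡g (_∷_ {x = x} p ps) = All.tabulate (λ {y} y∈ →
    subst₂ (λ fx fy → fy < fx ⊎ fy ≡ fx × stack x Fin.≤ stack y)
      (f≡g (here refl)) (f≡g (there y∈)) (All.lookup p y∈)) ∷ sorted-cong (f≡g ∘ there) ps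

  -- For every b in S, the residual height of each stack up to that of b differs
  -- from the height of b only by targets of S.
  Exposed : (Fin n → ℕ) → (Fin m → ℕ) → List (Fin n) → Set
  Exposed hb d S = ∀ {b} → b ∈ S → hb b < d (stack b) × (∀ t → t Fin.≤ stack b →
    hb b ≤ d t × (∀ k → hb b ≤ k → k < d t → ∃[ y ] y ∈ S × stack y ≡ t × hb y ≡ k))

  lower-≡ : ∀ d b → lower I d b (stack b) ≡ d (stack b) ∸ 1
  lower-≡ d b rewrite dec-true (stack b Fin.≟ stack b) refl = refl

  lower-≢ : ∀ d b {t} → t ≢ stack b → lower I d b t ≡ d t
  lower-≢ d b {t} t≢ rewrite dec-false (t Fin.≟ stack b) t≢ = refl

  exposed⇒retrievable : ∀ hb d S → Unique S →
    (∀ {b y} → b ∈ S → y ∈ S → stack y ≡ stack b → hb y ≡ hb b → y ≡ b) →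
    Sorted hb S → Exposed hb d S → Retrievable I hb d S
  exposed⇒retrievable hb d []      _          _   _              _       = tt
  exposed⇒retrievable hb d (b ∷ S) (b∉ ∷ S!) inj (first ∷ sorted) exposed =
    (own , left) , exposed⇒retrievable hb (lower I d b) S S!
      (λ b∈ y∈ → inj (there b∈) (there y∈)) sorted exposed′
    where
    s : Fin m
    s = stack b
    above : hb b < d s
    above = proj₁ (exposed (here refl))
    own : d s ≡ suc (hb b)
    own with m≤n⇒m<n∨m≡n above
    ... | inj₂ eq = sym eq
    ... | inj₁ lt with proj₂ (proj₂ (exposed (here refl)) s ≤-refl) (suc (hb b)) (n≤1+n _) lt
    ...   | y , here refl , _ , h≡ = contradiction (sym h≡) 1+n≢n
    ...   | y , there y∈ , _ , h≡ with All.lookup first y∈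
    ...     | inj₁ h< = contradiction (≤-trans h< (n≤1+n _)) (<-irrefl h≡)
    ...     | inj₂ (h≡′ , _) = contradiction (trans (sym h≡) h≡′) 1+n≢n
    left : ∀ t → t Fin.< s → d t ≡ hb b
    left t t<s with h≤ , gap ← proj₂ (exposed (here refl)) t (<⇒≤ t<s) with m≤n⇒m<n∨m≡n h≤
    ... | inj₂ eq = sym eq
    ... | inj₁ lt with gap (hb b) ≤-refl lt
    ...   | y , here refl , refl , _ = contradiction t<s (<-irrefl refl)
    ...   | y , there y∈ , refl , h≡ with All.lookup first y∈
    ...     | inj₁ h< = contradiction h< (<-irrefl h≡)
    ...     | inj₂ (_ , s≤t) = contradiction (<-≤-trans t<s s≤t) (<-irrefl refl)
    ≤first : ∀ {y} → y ∈ S → hb y ≤ hb b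
    ≤first y∈ = [ <⇒≤ , ≤-reflexive ∘ proj₁ ]′ (All.lookup first y∈)
    later : ∀ {t k} → (∃[ y ] y ∈ b ∷ S × stack y ≡ t × hb y ≡ k) → (s ≡ t → k ≢ hb b) →
           ∃[ y ] y ∈ S × stack y ≡ t × hb y ≡ k
    later (y , here refl , s≡ , h≡) k≢ = contradiction (sym h≡) (k≢ s≡)
    later (y , there y∈ , p)        _  = y , y∈ , p
    exposed′ : Exposed hb (lower I d b) S
    exposed′ {y} y∈ with old-own , old-left ← exposed (there y∈) = new-own , new-left
      where
      new-own : hb y < lower I d b (stack y)
      new-own with stack y Fin.≟ s
      ... | no s≢ = old-own
      ... | yes s≡ = subst (hb y <_) (sym (cong (_∸ 1) (trans (cong d s≡) own)))
              (≤∧≢⇒< (≤first y∈) λ h≡ → All.lookup b∉ y∈ (inj (there y∈) (here refl) (sym s≡) (sym h≡)))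
      new-left : ∀ t → t Fin.≤ stack y → hb y ≤ lower I d b t ×
                 (∀ k → hb y ≤ k → k < lower I d b t → ∃[ z ] z ∈ S × stack z ≡ t × hb z ≡ k)
      new-left t t≤ with old-≤ , gap ← old-left t t≤ with t Fin.≟ s
      ... | no t≢s = old-≤ , λ k h≤k k<d → later (gap k h≤k k<d) (λ s≡t → contradiction (sym s≡t) t≢s)
      ... | yes refl rewrite own = ≤first y∈ , λ k h≤k k<hb →
              later (gap k h≤k (m≤n⇒m≤1+n k<hb)) (λ _ → <⇒≢ k<hb)

  foldl-lower : ∀ d bs t → foldl (lower I) d bs t ≡ d t ∸ count (inStack? I t) bs
  foldl-lower d []       t = refl
  foldl-lower d (b ∷ bs) t with stack b Fin.≟ t
  ... | yes refl = trans (foldl-lower (lower I d b) bs t)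
                    (trans (cong (_∸ count (inStack? I t) bs) (lower-≡ d b)) (∸-+-assoc (d t) 1 _))
  ... | no  s≢t  = trans (foldl-lower (lower I d b) bs t)
                    (cong (_∸ count (inStack? I t) bs) (lower-≢ d b (s≢t ∘ sym)))

  retrievable⇒count≤ : ∀ hb d bs → Retrievable I hb d bs → ∀ t → count (inStack? I t) bs ≤ d t
  retrievable⇒count≤ hb d []       _                 t = z≤n
  retrievable⇒count≤ hb d (b ∷ bs) ((own , _) , ret) t
    with ih ← retrievable⇒count≤ hb (lower I d b) bs ret t with stack b Fin.≟ t
  ... | yes refl rewrite lower-≡ d b | own = s≤s ih
  ... | no  s≢t  rewrite lower-≢ d b {t} (s≢t ∘ sym) = ih

  nextStacks-≡ : ∀ hs hb ℓ bs → (∀ t → ℓ t ≤ hs t) → Retrievable I hb ℓ bs → ∀ t →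
                 nextStacks I hs (mkCycle ℓ bs) t ≡ hs t ∸ count (inStack? I t) bs
  nextStacks-≡ hs hb ℓ bs ℓ≤ ret t = begin
    foldl (lower I) ℓ bs t + (hs t ∸ ℓ t)  ≡⟨ cong (_+ (hs t ∸ ℓ t)) (foldl-lower ℓ bs t) ⟩
    ℓ t ∸ c + (hs t ∸ ℓ t)                 ≡⟨ +-comm (ℓ t ∸ c) _ ⟩
    hs t ∸ ℓ t + (ℓ t ∸ c)                 ≡⟨ +-∸-assoc (hs t ∸ ℓ t) (retrievable⇒count≤ hb ℓ bs ret t) ⟨
    hs t ∸ ℓ t + ℓ t ∸ c                   ≡⟨ cong (_∸ c) (m∸n+n≡m (ℓ≤ t)) ⟩
    hs t ∸ c                               ∎
    where
    open ≡-Reasoning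
    c : ℕ
    c = count (inStack? I t) bs

foldr-⊔-lub : ∀ (f : A → ℕ) {z u} xs → z ≤ u → (∀ {x} → x ∈ xs → f x ≤ u) →
              foldr _⊔_ z (map f xs) ≤ u
foldr-⊔-lub f []       z≤u f≤ = z≤u
foldr-⊔-lub f (x ∷ xs) z≤u f≤ = ⊔-lub (f≤ (here refl)) (foldr-⊔-lub f xs z≤u (f≤ ∘ there))

≤-foldr-⊔ : ∀ (f : A → ℕ) {z} xs → z ≤ foldr _⊔_ z (map f xs)
≤-foldr-⊔ f []       = ≤-refl
≤-foldr-⊔ f (x ∷ xs) = ≤-trans (≤-foldr-⊔ f xs) (m≤n⊔m (f x) _)

∈-≤-foldr-⊔ : ∀ (f : A → ℕ) {z x xs} → x ∈ xs → f x ≤ foldr _⊔_ z (map f xs)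
∈-≤-foldr-⊔ f (here refl) = m≤m⊔n (f _) _
∈-≤-foldr-⊔ f {xs = y ∷ _} (there x∈) = ≤-trans (∈-≤-foldr-⊔ f x∈) (m≤n⊔m (f y) _)

<-foldr-⊔ : ∀ (f : A → ℕ) {z k} xs → k < foldr _⊔_ z (map f xs) →
            k < z ⊎ ∃[ x ] x ∈ xs × k < f x
<-foldr-⊔ f []       k< = inj₁ k<
<-foldr-⊔ f {z} {k} (x ∷ xs) k< with ⊔-sel (f x) (foldr _⊔_ z (map f xs))
... | inj₁ eq = inj₂ (x , here refl , subst (k <_) eq k<)
... | inj₂ eq with <-foldr-⊔ f xs (subst (k <_) eq k<)
...   | inj₁ k<z            = inj₁ k<z
...   | inj₂ (y , y∈ , k<f) = inj₂ (y , there y∈ , k<f)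

module _ {m n : ℕ} (I : Instance m n) where
  open Instance I

  record Tracks (D : List (Fin n)) (hs : Fin m → ℕ) (hb : Fin n → ℕ) : Set where
    field
      stacks  : ∀ t → hs t ≡ stackHeightᴰ I D t
      targets : ∀ {b} → b ∉ D → hb b ≡ heightᴰ I D b

  module _ {D b₀ Y hs hb bs} (shape : Shape I D b₀ Y) (tracks : Tracks D hs hb)
           (bs↭Y : bs ↭ Y) (sorted : Sorted I (heightᴰ I D) bs) where
    open Shape shape
    open Tracks tracks

    private
      H : ℕ
      H = heightᴰ I D b₀
      ℓ : Fin m → ℕ
      ℓ = levels I hs hb (mkPlan H bs)
      D! : Unique D
      D! = proj₁ (proj₂ (Unique-++⁻ Y fresh))
      ∈Y : ∀ {y} → y ∈ bs → y ∈ Y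
      ∈Y = ∈-resp-↭ bs↭Y
      ∉D : ∀ {y} → y ∈ bs → y ∉ D
      ∉D y∈ = proj₂ (proj₂ (Unique-++⁻ Y fresh)) (∈Y y∈)
      in-stack : ∀ {t y} → y ∈ filter (inStack? I t) bs → y ∈ bs × stack y ≡ t
      in-stack {t} = ∈-filter⁻ (inStack? I t) {xs = bs}

      below-stack : ∀ {y} → y ∈ bs → hb y < hs (stack y)
      below-stack {y} y∈ = begin-strict
        hb y                        ≡⟨ targets (∉D y∈) ⟩
        heightᴰ I D y               <⟨ heightᴰ<stackHeightᴰ I D! (∉D y∈) ⟩
        stackHeightᴰ I D (stack y)  ≡⟨ stacks (stack y) ⟨
        hs (stack y)                ∎
        where open ≤-Reasoning

    levels≤ : ∀ t → ℓ t ≤ hs t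
    levels≤ t = foldr-⊔-lub (suc ∘ hb) (filter (inStack? I t) bs) (m⊓n≤n H (hs t))
      λ y∈ → case in-stack y∈ of λ { (y∈bs , refl) → below-stack y∈bs }

    private
      occ : ∀ {t k} → Occupied I D Y t k → ∃[ y ] y ∈ bs × stack y ≡ t × hb y ≡ k
      occ (y , y∈ , s≡ , h≡) = y , y∈bs , s≡ , trans (targets (∉D y∈bs)) h≡
        where
        y∈bs : y ∈ bs
        y∈bs = ∈-resp-↭ (↭-sym bs↭Y) y∈

      <ℓ : ∀ {y} → y ∈ bs → hb y < ℓ (stack y)
      <ℓ y∈ = ∈-≤-foldr-⊔ (suc ∘ hb) (∈-filter⁺ (inStack? I _) y∈ refl)

      fill-up : ∀ {t} d k → H ≤ k → Occupied I D Y t (d + k) → Occupied I D Y t k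
      fill-up zero    k H≤k o = o
      fill-up (suc d) k H≤k o = fill-up d k H≤k (stairs o (≤-trans H≤k (m≤n+m k d)) ≤-refl)

      fill-down : ∀ {t} d k → d + k < H → Occupied I D Y t k → Occupied I D Y t (d + k)
      fill-down zero    k _   o = o
      fill-down (suc d) k lt o = nested (fill-down d k (<-trans (n<1+n _) lt) o) lt

      exposed : Exposed I hb ℓ bs
      exposed {b} b∈ = <ℓ b∈ , λ t t≤s → h≤ t t≤s , gap t t≤s
        where
        h : ℕ
        h = heightᴰ I D b
        hb≡h : hb b ≡ h
        hb≡h = targets (∉D b∈)
        b-occ : Occupied I D Y (stack b) h
        b-occ = b , ∈Y b∈ , refl , refl
        reach : ∀ t → t Fin.≤ stack b → h ≤ hs t
        reach t t≤s with t Fin.≟ stack b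
        ... | yes refl = ≤-trans (≤-reflexive (sym hb≡h)) (<⇒≤ (below-stack b∈))
        ... | no t≢s = ≤-trans (reachable (∈Y b∈) t (≤∧≢⇒< t≤s (t≢s ∘ Fin.toℕ-injective)))
                         (≤-reflexive (sym (stacks t)))
        h≤ : ∀ t → t Fin.≤ stack b → hb b ≤ ℓ t
        h≤ t t≤s with h ≤? H
        ... | yes h≤H = ≤-trans (≤-reflexive hb≡h) (≤-trans (⊓-glb h≤H (reach t t≤s))
                          (≤-foldr-⊔ (suc ∘ hb) (filter (inStack? I t) bs)))
        ... | no h≰H with k , 1+k≡h ← (pred h , suc-pred h ⦃ >-nonZero (≤-trans (s≤s z≤n) (≰⇒> h≰H)) ⦄)
            with y , y∈ , refl , h≡ ← occ (stairs {k = k} (subst (Occupied I D Y (stack b)) (sym 1+k≡h) b-occ)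
                                       (s≤s⁻¹ (subst (H <_) (sym 1+k≡h) (≰⇒> h≰H))) t≤s)
            = ≤-trans (≤-reflexive (trans hb≡h (trans (sym 1+k≡h) (cong suc (sym h≡))))) (<ℓ y∈)
        low : ∀ {t k} → t Fin.≤ stack b → h ≤ k → k < H → Occupied I D Y t k
        low {t} {k} t≤s h≤k k<H = subst (Occupied I D Y t) (m∸n+n≡m h≤k)
          (fill-down (k ∸ h) h (subst (_< H) (sym (m∸n+n≡m h≤k)) k<H) (rows b-occ (≤-<-trans h≤k k<H) t≤s))
        gap : ∀ t → t Fin.≤ stack b → ∀ k → hb b ≤ k → k < ℓ t →
              ∃[ y ] y ∈ bs × stack y ≡ t × hb y ≡ k
        gap t t≤s k hb≤k k<ℓ with h≤k ← subst (_≤ k) hb≡h hb≤k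
            with k <? H | <-foldr-⊔ (suc ∘ hb) (filter (inStack? I t) bs) k<ℓ
        ... | yes k<H | _ = occ (low t≤s h≤k k<H)
        ... | no k≮H | inj₁ k<base = contradiction (<-≤-trans k<base (m⊓n≤m H (hs t))) k≮H
        ... | no k≮H | inj₂ (y , y∈ , s≤s k≤hy) with y∈bs , refl ← in-stack y∈ =
              occ (fill-up (heightᴰ I D y ∸ k) k (≮⇒≥ k≮H)
                (subst (Occupied I D Y t) (sym (m∸n+n≡m (subst (k ≤_) (targets (∉D y∈bs)) k≤hy)))
                  (y , ∈Y y∈bs , refl , refl)))

    levels-retrievable : Retrievable I hb ℓ bs
    levels-retrievable = exposed⇒retrievable I hb ℓ bs
      (proj₁ (Unique-++⁻ bs (Unique-↭ (++⁺ʳ D (↭-sym bs↭Y)) fresh)))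
      (λ b∈ y∈ s≡ h≡ → heightᴰ-injective I D! (∉D b∈) (∉D y∈) s≡
         (trans (sym (targets (∉D y∈))) (trans h≡ (targets (∉D b∈)))))
      (sorted-cong I (λ y∈ → sym (targets (∉D y∈))) sorted) exposed

    tracks-next : Tracks (Y ++ D) (nextStacks I hs (mkCycle ℓ bs)) (nextTargets I hb bs)
    tracks-next = record
      { stacks = λ t → begin
          nextStacks I hs (mkCycle ℓ bs) t
            ≡⟨ nextStacks-≡ I hs hb ℓ bs levels≤ levels-retrievable t ⟩
          hs t ∸ count (inStack? I t) bs
            ≡⟨ cong₂ _∸_ (stacks t) (count-↭ (inStack? I t) bs↭Y) ⟩
          stackHeightᴰ I D t ∸ count (inStack? I t) Y
            ≡⟨ stackHeightᴰ-++ I Y D t ⟨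
          stackHeightᴰ I (Y ++ D) t ∎
      ; targets = λ {b} b∉ → let b∉D = b∉ ∘ ∈-++⁺ʳ Y in begin
          nextTargets I hb bs b
            ≡⟨ cong₂ _∸_ (targets b∉D) (count-cong _ (below? I b) bs
                 (λ y∈ (s≡ , y<b) → s≡ , heightᴰ-cancel-< I D! b∉D s≡
                    (subst₂ _<_ (targets (∉D y∈)) (targets b∉D) y<b))
                 (λ y∈ (s≡ , y<b) → s≡ , subst₂ _<_ (sym (targets (∉D y∈))) (sym (targets b∉D))
                    (heightᴰ-mono-< I D! (∉D y∈) s≡ y<b))) ⟩
          heightᴰ I D b ∸ count (below? I b) bs  ≡⟨ cong (heightᴰ I D b ∸_) (count-↭ (below? I b) bs↭Y) ⟩
          heightᴰ I D b ∸ count (below? I b) Y   ≡⟨ heightᴰ-++ I Y D b ⟨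
          heightᴰ I (Y ++ D) b                   ∎
      }
      where open ≡-Reasoning

  data Planned (D : List (Fin n)) : List (Plan n) → List (List (Fin n)) → Set where
    finished : (∀ b → b ∈ D) → Planned D [] []
    cycle    : ∀ {b₀ Y bs ps Ys} → Shape I D b₀ Y → bs ↭ Y → Sorted I (heightᴰ I D) bs →
               Planned (Y ++ D) ps Ys → Planned D (mkPlan (heightᴰ I D b₀) bs ∷ ps) (Y ∷ Ys)

  planned⇒valid : ∀ {D hs hb ps Ys} → Tracks D hs hb → Planned D ps Ys →
                  ValidFrom I hs hb (decodeFrom I hs hb ps)
  planned⇒valid tracks (finished _) = tt
  planned⇒valid tracks (cycle shape bs↭Y sorted planned) =
    levels≤ shape tracks bs↭Y sorted , levels-retrievable shape tracks bs↭Y sorted ,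
    planned⇒valid (tracks-next shape tracks bs↭Y sorted) planned

  planned⇒complete : ∀ {D ps Ys} hs hb → Unique D → Planned D ps Ys →
                     concatMap Cycle.order (decodeFrom I hs hb ps) ++ D ↭ allFin n
  planned⇒complete hs hb D! (finished all∈) =
    unique∧set⇒↭ D! (allFin⁺ n) (λ _ → ∈-allFin _) (λ _ → all∈ _)
  planned⇒complete {D} hs hb D! (cycle {Y = Y} {bs} {ps} shape bs↭Y _ planned) = begin
    (bs ++ rest) ++ D  ↭⟨ ++⁺ʳ D (++-comm bs rest) ⟩
    (rest ++ bs) ++ D  ≡⟨ ++-assoc rest bs D ⟩
    rest ++ bs ++ D    ↭⟨ ++⁺ˡ rest (++⁺ʳ D bs↭Y) ⟩
    rest ++ Y ++ D     ↭⟨ planned⇒complete _ _ (Shape.fresh shape) planned ⟩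
    allFin n           ∎
    where
    open PermutationReasoning
    rest : List (Fin n)
    rest = concatMap Cycle.order (decodeFrom I _ _ ps)

  planned⇒pointwise : ∀ {D ps Ys} → Planned D ps Ys →
                      Pointwise (λ p Y → Plan.sequence p ↭ Y) ps Ys
  planned⇒pointwise (finished _)               = []
  planned⇒pointwise (cycle _ bs↭Y _ planned) = bs↭Y ∷ planned⇒pointwise planned

  decode-pointwise : ∀ {ps Ys} hs hb → Pointwise (λ p Y → Plan.sequence p ↭ Y) ps Ys →
                     Pointwise (λ c Y → Cycle.order c ↭ Y) (decodeFrom I hs hb ps) Ys
  decode-pointwise hs hb []         = []
  decode-pointwise hs hb (p↭Y ∷ ps) = p↭Y ∷ decode-pointwise _ _ ps

  planned⇒feasible : ∀ {ps Ys} → Planned [] ps Ys → FeasibleSolution I (decode I ps)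
  planned⇒feasible planned =
    planned⇒valid (record { stacks = λ _ → refl ; targets = λ _ → refl }) planned ,
    subst (_↭ allFin n) (++-identityʳ _) (planned⇒complete stackHeight height [] planned)

-- Correctness of the tests of the program

module _ {m n : ℕ} (I : Instance m n) where
  open Instance I

  supplied-∷ : ∀ {b D} → Supplied I D →
               (∀ x → x ∉ b ∷ D → stack b Fin.< stack x → demand I x ≤ stackHeightᴰ I (b ∷ D) (stack b)) →
               Supplied I (b ∷ D)
  supplied-∷ {b} {D} supp own x x∉ t t<s = case stack b Fin.≟ t of λ
    { (yes refl) → own x x∉ t<s
    ; (no s≢t)   → ≤-trans (supp x (x∉ ∘ there) t t<s)
        (≤-reflexive (cong (stackHeight t ∸_) (sym (count-no (inStack? I t) {xs = D} s≢t)))) }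

  supplied-start : ∀ {D b′} → Unique D → Supplied I D → Initial I D b′ → Supplied I (b′ ∷ D)
  supplied-start {D} {b′} D! supp (b , (b∉D , highest) , b′∉D , s≡ , _) = supplied-∷ supp λ x x∉ t<s →
    let lower-than-b : heightᴰ I D x < heightᴰ I D b
        lower-than-b = case highest x (x∉ ∘ there) of λ
          { (inj₁ x<b)       → x<b
          ; (inj₂ (_ , x≤b)) →
              contradiction (<-≤-trans t<s (subst (stack x Fin.≤_) (sym s≡) x≤b)) (<-irrefl refl) }
    in begin
    demand I x
      ≡⟨ demand-invariant I D! x ⟨
    heightᴰ I D x ∸ Rᴰ I D x
      ≤⟨ m∸n≤m _ (Rᴰ I D x) ⟩
    heightᴰ I D x
      ≤⟨ m+n≤o⇒m≤o∸n _ (≤-trans (≤-reflexive (+-comm _ 1)) (<-trans lower-than-b b<top)) ⟩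
    stackHeightᴰ I D t ∸ 1
      ≡⟨ cong (stackHeightᴰ I D t ∸_) (count-yes (inStack? I t) {xs = []} refl) ⟨
    stackHeightᴰ I D t ∸ count (inStack? I t) [ b′ ]
      ≡⟨ stackHeightᴰ-++ I [ b′ ] D t ⟨
    stackHeightᴰ I (b′ ∷ D) t ∎
    where
    open ≤-Reasoning
    t : Fin m
    t = stack b′
    b<top : heightᴰ I D b < stackHeightᴰ I D t
    b<top = subst (λ u → heightᴰ I D b < stackHeightᴰ I D u) (sym s≡) (heightᴰ<stackHeightᴰ I D! b∉D)

  -- The lowest remaining target of a stack is demanded at its own height.
  reachable-in-stack : ∀ {D} → Unique D → Supplied I D → ∀ k b → height b < k → b ∉ D →
                       ∃[ x ] x ∉ D × stack x ≡ stack b × Reachable I D x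
  reachable-in-stack {D} D! supp (suc k) b (s≤s b≤k) b∉D with Rᴰ I D b in R≡
  ... | zero  = b , b∉D , refl , λ t t<s → subst (_≤ stackHeightᴰ I D t)
                  (trans (sym (demand-invariant I D! b)) (cong (heightᴰ I D b ∸_) R≡)) (supp b b∉D t t<s)
  ... | suc _ with y , _ , (s≡ , y<b) , y∉D ← count>0⁻ _ (allFin n) (subst (0 <_) (sym R≡) (s≤s z≤n))
        with x , x∉D , s≡′ , reach ← reachable-in-stack D! supp k y (<-≤-trans y<b b≤k) y∉D
        = x , x∉D , trans s≡′ s≡ , reach

  module Complement (R {E} : List (Fin n)) (split : R ++ E ↭ allFin n) where
    unique : Unique (R ++ E)
    unique = Unique-↭ (↭-sym split) (allFin⁺ n)

    left-unique : Unique R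
    left-unique = proj₁ (Unique-++⁻ R unique)

    right-unique : Unique E
    right-unique = proj₁ (proj₂ (Unique-++⁻ R unique))

    ∈⇒∉ : ∀ {b} → b ∈ R → b ∉ E
    ∈⇒∉ = proj₂ (proj₂ (Unique-++⁻ R unique))

    ∉⇒∈ : ∀ {b} → b ∉ E → b ∈ R
    ∉⇒∈ b∉E = [ id , (λ b∈E → contradiction b∈E b∉E) ]′ (∈-++⁻ R (∈-resp-↭ (↭-sym split) (∈-allFin _)))

    length≤ : length R ≤ n
    length≤ = ≤-trans (m≤m+n _ _) (≤-reflexive
      (trans (sym (length-++ R)) (trans (↭-length split) (length-tabulate id))))

  record Growing (D : List (Fin n)) (a : Fin n) (cand Y : List (Fin n)) : Set where
    field
      batch    : Batch I D Y
      anchor   : Anchor I Y a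
      shape    : Shape I D a Y
      split    : cand ++ Y ++ D ↭ allFin n
      supplied : Supplied I (Y ++ D)

  low : Vector ℕ m
  low = value (prefixMinima stackHeight)

  module _ {D : List (Fin n)} {hs : Vector ℕ m} {hb rb : Vector ℕ n} (D! : Unique D)
    (tracks : Tracks I D hs hb) (ranks : ∀ {b} → b ∉ D → rb b ≡ Rᴰ I D b) where

    open Tracks tracks

    accessibleᵗ-reflects : ∀ {b} → b ∉ D → Reflects (Reachable I D b) (value (accessibleᵗ I low hs hb b))
    accessibleᵗ-reflects {b} b∉D = reflects-map sound complete
      (≤ᵇ-reflects-≤ _ _ ∧ʳ allᵗ-reflects {P = λ x → stack b Fin.≤ stack x ⊎ hb b ≤ hs (stack x)}
        (allFin n) λ _ → ≤ᵇ-reflects-≤ _ _ ∨ʳ ≤ᵇ-reflects-≤ _ _)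
      where
      h≡ : hb b ≡ heightᴰ I D b
      h≡ = targets b∉D
      sound : hb b ≤ low (stack b) × (∀ x → x ∈ allFin n → stack b Fin.≤ stack x ⊎ hb b ≤ hs (stack x)) →
              Reachable I D b
      sound (b≤low , all) t t<s with count (inStack? I t) D in c≡
      ... | zero  = subst (_≤ stackHeight t) h≡ (≤-trans b≤low (prefixMinima-≤ stackHeight (<⇒≤ t<s)))
      ... | suc _ with x , _ , refl ← count>0⁻ (inStack? I t) D (subst (0 <_) (sym c≡) (s≤s z≤n))
        with all x (∈-allFin x)
      ...   | inj₁ s≤t = contradiction (<-≤-trans t<s s≤t) (<-irrefl refl)
      ...   | inj₂ b≤t = subst₂ _≤_ h≡ (trans (stacks t) (cong (stackHeight t ∸_) c≡)) b≤t
      complete : Reachable I D b →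
                 hb b ≤ low (stack b) × (∀ x → x ∈ allFin n → stack b Fin.≤ stack x ⊎ hb b ≤ hs (stack x))
      complete reach = prefixMinima-glb stackHeight below-all , λ x _ → beside x
        where
        at : ∀ t → t Fin.≤ stack b → hb b ≤ stackHeightᴰ I D t
        at t t≤s with t Fin.≟ stack b
        ... | yes refl = subst (_≤ _) (sym h≡) (<⇒≤ (heightᴰ<stackHeightᴰ I D! b∉D))
        ... | no t≢s   = subst (_≤ _) (sym h≡) (reach t (≤∧≢⇒< t≤s (t≢s ∘ Fin.toℕ-injective)))
        below-all : ∀ t → t Fin.≤ stack b → hb b ≤ stackHeight t
        below-all t t≤s = ≤-trans (at t t≤s) (m∸n≤m (stackHeight t) (count (inStack? I t) D))
        beside : ∀ x → stack b Fin.≤ stack x ⊎ hb b ≤ hs (stack x)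
        beside x with ≤-<-connex (toℕ (stack b)) (toℕ (stack x))
        ... | inj₁ s≤t = inj₁ s≤t
        ... | inj₂ t<s = inj₂ (subst (hb b ≤_) (sym (stacks (stack x))) (at (stack x) (<⇒≤ t<s)))

    module _ {a cand Y} (growing : Growing D a cand Y) where
      open Growing growing
      open Shape shape using (fresh; first∈)
      open Complement cand split using (∈⇒∉; ∉⇒∈)

      private
        Y∉D : ∀ {y} → y ∈ Y → y ∉ D
        Y∉D = proj₂ (proj₂ (Unique-++⁻ Y fresh))
        Y≡ : ∀ {y} → y ∈ Y → hb y ≡ heightᴰ I D y
        Y≡ y∈ = targets (Y∉D y∈)

      module _ {b} (b∈ : b ∈ cand) where

        private
          b∉Y : b ∉ Y
          b∉Y = ∈⇒∉ b∈ ∘ ∈-++⁺ˡ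
          b∉D : b ∉ D
          b∉D = ∈⇒∉ b∈ ∘ ∈-++⁺ʳ Y
          b≡ : hb b ≡ heightᴰ I D b
          b≡ = targets b∉D

        occupied-reflects : ∀ {t k} {p : Fin n → Timed Bool} →
          (∀ y → y ∈ Y → Reflects (stack y ≡ t × heightᴰ I D y ≡ k) (value (p y))) →
          Reflects (Occupied I D Y t k) (value (anyᵗ p Y))
        occupied-reflects r = anyᵗ-reflects Y λ y∈ → r _ y∈

        c1ᵗ-reflects : Reflects (C1 I D Y a b) (value (c1ᵗ I low hs hb rb a Y b))
        c1ᵗ-reflects = reflects-map (λ e → trans (sym b≡) (trans e (Y≡ first∈)))
          (λ e → trans b≡ (trans e (sym (Y≡ first∈)))) (≡ᵇ-reflects-≡ _ _)

        c2ᵗ-reflects : Reflects (C2 I D Y a b) (value (c2ᵗ I low hs hb rb a Y b))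
        c2ᵗ-reflects = reflects-map sound complete (≡ᵇ-reflects-≡ _ _)
          where
          below : Fin n → Set
          below y = suc (hb y) ≡ hb b
          module PH = Pigeonhole {P = below} (λ y → suc (hb y) ≟ hb b) (toℕ ∘ stack)
            (proj₁ (Unique-++⁻ Y fresh)) (λ x∈ y∈ px py s≡ →
              heightᴰ-injective I D! (Y∉D y∈) (Y∉D x∈) (Fin.toℕ-injective s≡)
                (trans (sym (Y≡ x∈)) (trans (suc-injective (trans px (sym py))) (Y≡ y∈))))
          s : ℕ
          s = toℕ (stack b)
          counted : ℕ
          counted = value (countᵗ (λ y → (col I y ≤ᵗ col I b) ∧ᵗ (sucᵗ (hb ! y) ==ᵗ hb ! b)) Y)
          counted≡ : counted ≡ PH.count< (suc s)
          counted≡ = countᵗ-value _ Y λ _ →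
            reflects-map (λ (le , e) → e , s≤s le) (λ (e , lt) → s≤s⁻¹ lt , e)
            (≤ᵇ-reflects-≤ _ _ ∧ʳ ≡ᵇ-reflects-≡ _ _)
          sound : counted ≡ suc s → C2 I D Y a b
          sound full with hit ← PH.full⇒hit (suc s) (trans (sym counted≡) full)
              with x , _ , x-below , _ ← hit s ≤-refl
            = hb x , trans (sym b≡) (sym x-below) , λ t t≤s →
              let y , y∈ , y-below , s≡ = hit (toℕ t) (s≤s t≤s) in
              y , y∈ , Fin.toℕ-injective s≡ ,
              trans (sym (Y≡ y∈)) (suc-injective (trans y-below (sym x-below)))
          complete : C2 I D Y a b → counted ≡ suc s
          complete (k , h≡ , row) = trans counted≡ (PH.hit⇒full (suc s) λ v v<1+s →
            let v<m = <-≤-trans v<1+s (Fin.toℕ<n (stack b))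
                y , y∈ , s≡ , hy≡ = row (Fin.fromℕ< v<m)
                  (subst (_≤ s) (sym (Fin.toℕ-fromℕ< v<m)) (s≤s⁻¹ v<1+s))
            in y , y∈ , trans (cong suc (trans (Y≡ y∈) hy≡)) (trans (sym h≡) (sym b≡)) ,
               trans (cong toℕ s≡) (Fin.toℕ-fromℕ< v<m))

        c3ᵗ-reflects : Reflects (C3 I D Y a b) (value (c3ᵗ I low hs hb rb a Y b))
        c3ᵗ-reflects =
          (reflects-map (λ e → trans (cong suc (sym b≡)) (trans e (Y≡ first∈)))
             (λ e → trans (cong suc b≡) (trans e (sym (Y≡ first∈)))) (≡ᵇ-reflects-≡ _ _)
           ∨ʳ occupied-reflects λ y y∈ →
             reflects-map (λ (s≡ , e) → Fin.toℕ-injective s≡ , trans (sym (Y≡ y∈)) (trans e (cong suc b≡)))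
               (λ (s≡ , e) → cong toℕ s≡ , trans (Y≡ y∈) (trans e (cong suc (sym b≡))))
               (≡ᵇ-reflects-≡ _ _ ∧ʳ ≡ᵇ-reflects-≡ _ _))
          ∧ʳ (≡ᵇ-reflects-≡ _ _ ∨ʳ reflects-map
             (λ (y , y∈ , s≡ , e) → stack y , s≡ , y , y∈ , refl , trans (sym (Y≡ y∈)) (trans e b≡))
             (λ { (_ , s≡ , y , y∈ , refl , e) → y , y∈ , s≡ , trans (Y≡ y∈) (trans e (sym b≡)) })
             (anyᵗ-reflects {P = λ y → suc (toℕ (stack y)) ≡ toℕ (stack b) × hb y ≡ hb b} Y
               λ _ → ≡ᵇ-reflects-≡ _ _ ∧ʳ ≡ᵇ-reflects-≡ _ _))

        staysFeasibleᵗ-reflects :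
          Reflects (Supplied I (b ∷ Y ++ D)) (value (staysFeasibleᵗ I low hs hb rb cand Y b))
        staysFeasibleᵗ-reflects = reflects-map sound complete
          (allᵗ-reflects {P = λ x → stack x Fin.≤ stack b ⊎ hb x ∸ rb x ≤ room} cand
            λ _ → ≤ᵇ-reflects-≤ _ _ ∨ʳ ≤ᵇ-reflects-≤ _ _)
          where
          room : ℕ
          room = hs (stack b) ∸ suc (value (countᵗ (λ y → col I y ==ᵗ col I b) Y))
          room≡ : room ≡ stackHeightᴰ I (b ∷ Y ++ D) (stack b)
          room≡ = begin
            room
              ≡⟨ cong₂ (λ h c → h ∸ suc c) (stacks (stack b)) (countᵗ-value (inStack? I (stack b)) Y λ _ →
                   reflects-map Fin.toℕ-injective (cong toℕ) (≡ᵇ-reflects-≡ _ _)) ⟩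
            stackHeightᴰ I D (stack b) ∸ suc (count (inStack? I (stack b)) Y)
              ≡⟨ cong (stackHeightᴰ I D (stack b) ∸_) (count-yes (inStack? I (stack b)) {xs = Y} refl) ⟨
            stackHeightᴰ I D (stack b) ∸ count (inStack? I (stack b)) (b ∷ Y)
              ≡⟨ stackHeightᴰ-++ I (b ∷ Y) D (stack b) ⟨
            stackHeightᴰ I (b ∷ Y ++ D) (stack b) ∎
            where open ≡-Reasoning
          demand≡ : ∀ {x} → x ∉ D → hb x ∸ rb x ≡ demand I x
          demand≡ {x} x∉D = trans (cong₂ _∸_ (targets x∉D) (ranks x∉D)) (demand-invariant I D! x)
          sound : (∀ x → x ∈ cand → stack x Fin.≤ stack b ⊎ hb x ∸ rb x ≤ room) → Supplied I (b ∷ Y ++ D)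
          sound ok = supplied-∷ supplied λ x x∉ t<s → case ok x (∉⇒∈ (x∉ ∘ there)) of λ
            { (inj₁ s≤) → contradiction (<-≤-trans t<s s≤) (<-irrefl refl)
            ; (inj₂ le) → subst₂ _≤_ (demand≡ (x∉ ∘ there ∘ ∈-++⁺ʳ Y)) room≡ le }
          complete : Supplied I (b ∷ Y ++ D) → ∀ x → x ∈ cand → stack x Fin.≤ stack b ⊎ hb x ∸ rb x ≤ room
          complete supp x x∈ with ≤-<-connex (toℕ (stack x)) (toℕ (stack b))
          ... | inj₁ s≤ = inj₁ s≤
          ... | inj₂ s< = inj₂ (subst₂ _≤_ (sym (demand≡ (∈⇒∉ x∈ ∘ ∈-++⁺ʳ Y))) (sym room≡)
                (supp x (λ { (here refl) → <-irrefl refl s< ; (there x∈′) → ∈⇒∉ x∈ x∈′ }) (stack b) s<))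

        legalᵗ-reflects : Reflects (Legal I D Y a b) (value (legalᵗ I low hs hb rb a cand Y b))
        legalᵗ-reflects = reflects-map
          (λ (reach , b≤a , ext , supp) → record
            { notRetrieved  = b∉D
            ; notInBatch    = b∉Y
            ; accessible    = Reachable⇒Accessible I D! b∉D reach
            ; left          = b≤a
            ; extends       = ext
            ; staysFeasible = Supplied⇒Feasible I fresh′ supp
            })
          (λ legal → let open Legal legal in
            Accessible⇒Reachable I D accessible , left , extends , Feasible⇒Supplied I fresh′ staysFeasible)
          (accessibleᵗ-reflects b∉D ∧ʳ ≤ᵇ-reflects-≤ _ _ ∧ʳ
            (c1ᵗ-reflects ∨ʳ c2ᵗ-reflects ∨ʳ c3ᵗ-reflects) ∧ʳ staysFeasibleᵗ-reflects)
          where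
          fresh′ : Unique (b ∷ Y ++ D)
          fresh′ = ∉-∷ (∈⇒∉ b∈) ∷ fresh

  module _ (low hs : Vector ℕ m) (hb rb : Vector ℕ n) where

    removeᵗ-↭ : ∀ {b cand} → Unique cand → b ∈ cand → cand ↭ b ∷ value (removeᵗ I low hs hb rb b cand)
    removeᵗ-↭ {b} {cand} cand! b∈ = unique∧set⇒↭ cand!
      (∉-∷ (λ b∈′ → proj₂ (kept b∈′) refl) ∷ filterᵗ-unique _ cand!)
      (λ {x} x∈ → case x Fin.≟ b of λ
        { (yes refl) → here refl
        ; (no x≢b)   → there (∈-filterᵗ⁺ _ distinct-reflects x∈ x≢b) })
      (λ { (here refl) → b∈ ; (there x∈) → proj₁ (kept x∈) })
      where
      distinct-reflects : ∀ {x} → x ∈ cand →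
        Reflects (x ≢ b) (value (notᵗ (return (toℕ x) ==ᵗ return (toℕ b))))
      distinct-reflects _ = reflects-map (_∘ cong toℕ) (_∘ Fin.toℕ-injective)
        (¬-reflects (≡ᵇ-reflects-≡ _ _))
      kept : ∀ {x} → x ∈ value (removeᵗ I low hs hb rb b cand) → x ∈ cand × x ≢ b
      kept = ∈-filterᵗ⁻ _ cand distinct-reflects

-- Costs of the parts of a cycle

module Linear {n : ℕ} (1≤n : 1 ≤ n) where

  1≤n*n : 1 ≤ n * n
  1≤n*n = *-mono-≤ 1≤n 1≤n

  constant : ∀ {s} → 1 ≤ s → ∀ c → c ≤ c * s
  constant {s} 1≤s c = ≤-trans (≤-reflexive (sym (*-identityʳ c))) (*-monoʳ-≤ c 1≤s)

  linear : ∀ c → c ≤ c * n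
  linear = constant 1≤n

  quadratic : ∀ c → c ≤ c * (n * n)
  quadratic = constant 1≤n*n

  infixr 5 _⊞_
  _⊞_ : ∀ {s x y} {a b : ℕ} → x ≤ a * s → y ≤ b * s → x + y ≤ (a + b) * s
  _⊞_ {s} {a = a} {b} x≤ y≤ = ≤-trans (+-mono-≤ x≤ y≤) (≤-reflexive (sym (*-distribʳ-+ s a b)))

  ∧-linear : ∀ {a b : ℕ} x y → cost x ≤ a * n → cost y ≤ b * n → cost (x ∧ᵗ y) ≤ (a + (1 + b)) * n
  ∧-linear {a} {b} x y x≤ y≤ = ≤-trans (∧ᵗ-cost x y x≤ y≤)
    (_⊞_ {a = a} {1 + b} ≤-refl (_⊞_ {a = 1} {b} (linear 1) ≤-refl))

  ∨-linear : ∀ {a b : ℕ} x y → cost x ≤ a * n → cost y ≤ b * n → cost (x ∨ᵗ y) ≤ (a + (1 + b)) * n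
  ∨-linear {a} {b} x y x≤ y≤ = ≤-trans (∨ᵗ-cost x y x≤ y≤)
    (_⊞_ {a = a} {1 + b} ≤-refl (_⊞_ {a = 1} {b} (linear 1) ≤-refl))

  loop : ∀ {l x} c → l ≤ n → x ≤ 1 + l * (2 + c) → x ≤ (3 + c) * n
  loop {l} c l≤n x≤ = ≤-trans x≤ (_⊞_ {a = 1} {2 + c} (linear 1)
    (≤-trans (*-monoˡ-≤ (2 + c) l≤n) (≤-reflexive (*-comm n (2 + c)))))

  loop² : ∀ {l x} c → l ≤ n → x ≤ 1 + l * (2 + c * n) → x ≤ (3 + c) * (n * n)
  loop² {l} {x} c l≤n x≤ = begin
    x                            ≤⟨ x≤ ⟩
    1 + l * (2 + c * n)          ≤⟨ +-mono-≤ (quadratic 1) (*-mono-≤ l≤n (+-monoˡ-≤ (c * n) (linear 2))) ⟩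
    1 * (n * n) + n * (2 * n + c * n) ≡⟨ cong (λ k → 1 * (n * n) + n * k) (*-distribʳ-+ n 2 c) ⟨
    1 * (n * n) + n * ((2 + c) * n)   ≡⟨ cong (1 * (n * n) +_) (*-comm n ((2 + c) * n)) ⟩
    1 * (n * n) + (2 + c) * n * n     ≡⟨ cong (1 * (n * n) +_) (*-assoc (2 + c) n n) ⟩
    1 * (n * n) + (2 + c) * (n * n)   ≡⟨ *-distribʳ-+ (n * n) 1 (2 + c) ⟨
    (3 + c) * (n * n)            ∎
    where open ≤-Reasoning

  squared : ∀ {x} c → x ≤ c * n → x ≤ c * (n * n)
  squared c x≤ = ≤-trans x≤ (*-monoʳ-≤ c (≤-trans (≤-reflexive (sym (*-identityʳ n))) (*-monoʳ-≤ n 1≤n)))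

  allFin≤ : length (allFin n) ≤ n
  allFin≤ = ≤-reflexive (length-tabulate id)

module Costs {m n : ℕ} (I : Instance m n) (1≤n : 1 ≤ n)
  (low hs : Vector ℕ m) (hb rb : Vector ℕ n) where

  open Instance I
  open Linear 1≤n

  accessibleᵗ-cost : ∀ b → cost (accessibleᵗ I low hs hb b) ≤ 16 * n
  accessibleᵗ-cost b = _⊞_ {n} {a = 1} {15} (linear 1)
    (∧-linear {3} {11} (hb ! b ≤ᵗ low ! stack b) _ (linear 3)
      (loop 8 allFin≤ (allᵗ-cost (allFin n) λ x →
        ∨ᵗ-cost (col I b ≤ᵗ col I x) (hb ! b ≤ᵗ ((stack ! x) >>= (hs !_))) ≤-refl ≤-refl)))

  module _ (a : Fin n) {cand Y : List (Fin n)} (cand≤ : length cand ≤ n) (Y≤ : length Y ≤ n) where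

    c2ᵗ-cost : ∀ b → cost (c2ᵗ I low hs hb rb a Y b) ≤ 14 * n
    c2ᵗ-cost b = _⊞_ {n} {a = 11} {3} (loop 8 Y≤ (countᵗ-cost Y λ y →
      ∧ᵗ-cost (col I y ≤ᵗ col I b) (sucᵗ (hb ! y) ==ᵗ hb ! b) ≤-refl ≤-refl)) (linear 3)

    c3ᵗ-cost : ∀ b → cost (c3ᵗ I low hs hb rb a Y b) ≤ 31 * n
    c3ᵗ-cost b = ∧-linear {16} {14}
      ((sucᵗ (hb ! b) ==ᵗ hb ! a) ∨ᵗ anyᵗ (λ y → (col I y ==ᵗ col I b) ∧ᵗ (hb ! y ==ᵗ sucᵗ (hb ! b))) Y)
      ((col I b ==ᵗ return 0) ∨ᵗ anyᵗ (λ y → (sucᵗ (col I y) ==ᵗ col I b) ∧ᵗ (hb ! y ==ᵗ hb ! b)) Y)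
      (∨-linear {4} {11} (sucᵗ (hb ! b) ==ᵗ hb ! a) _ (linear 4)
        (loop 8 Y≤ (anyᵗ-cost Y λ y →
          ∧ᵗ-cost (col I y ==ᵗ col I b) (hb ! y ==ᵗ sucᵗ (hb ! b)) ≤-refl ≤-refl)))
      (∨-linear {2} {11} (col I b ==ᵗ return 0) _ (linear 2)
        (loop 8 Y≤ (anyᵗ-cost Y λ y →
          ∧ᵗ-cost (sucᵗ (col I y) ==ᵗ col I b) (hb ! y ==ᵗ hb ! b) ≤-refl ≤-refl)))

    staysFeasibleᵗ-cost : ∀ b → cost (staysFeasibleᵗ I low hs hb rb cand Y b) ≤ 21 * n
    staysFeasibleᵗ-cost b = _⊞_ {n} {a = 1} {20} (linear 1) (_⊞_ {n} {a = 9} {11}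
      (_⊞_ {n} {a = 1} {8} (linear 1) (_⊞_ {n} {a = 7} {1}
        (_⊞_ {n} {a = 6} {1} (loop 3 Y≤ (countᵗ-cost Y λ y → ≤-refl)) (linear 1)) (linear 1)))
      (loop 8 cand≤ (allᵗ-cost cand λ x →
        ∨ᵗ-cost (col I x ≤ᵗ col I b) (hb ! x ∸ᵗ rb ! x ≤ᵗ return (value
          (hs ! stack b ∸ᵗ sucᵗ (countᵗ (λ y → col I y ==ᵗ col I b) Y)))) ≤-refl ≤-refl)))

    legalᵗ-cost : ∀ b → cost (legalᵗ I low hs hb rb a cand Y b) ≤ 93 * n
    legalᵗ-cost b = ∧-linear {16} {76} (accessibleᵗ I low hs hb b) _ (accessibleᵗ-cost b)
      (∧-linear {3} {72} (col I b ≤ᵗ col I a) _ (linear 3)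
        (∧-linear {50} {21}
          (c1ᵗ I low hs hb rb a Y b ∨ᵗ c2ᵗ I low hs hb rb a Y b ∨ᵗ c3ᵗ I low hs hb rb a Y b) _
          (∨-linear {3} {46} (c1ᵗ I low hs hb rb a Y b) _ (linear 3)
            (∨-linear {14} {31} (c2ᵗ I low hs hb rb a Y b) (c3ᵗ I low hs hb rb a Y b)
              (c2ᵗ-cost b) (c3ᵗ-cost b)))
          (staysFeasibleᵗ-cost b)))

    legal-filter-cost : cost (filterᵗ (legalᵗ I low hs hb rb a cand Y) cand) ≤ 96 * (n * n)
    legal-filter-cost = loop² 93 cand≤ (filterᵗ-cost cand legalᵗ-cost)

  removeᵗ-cost : ∀ b {cand} → length cand ≤ n → cost (removeᵗ I low hs hb rb b cand) ≤ 6 * (n * n)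
  removeᵗ-cost b {cand} cand≤ = squared 6 (loop 3 cand≤ (filterᵗ-cost cand λ x → s≤s (s≤s z≤n)))

  earlierᵗ-cost : ∀ y z → cost ((hb ! z <ᵗ hb ! y) ∨ᵗ (hb ! z ==ᵗ hb ! y) ∧ᵗ (col I y ≤ᵗ col I z)) ≤ 11
  earlierᵗ-cost y z = ∨ᵗ-cost (hb ! z <ᵗ hb ! y) _ ≤-refl
    (∧ᵗ-cost (hb ! z ==ᵗ hb ! y) (col I y ≤ᵗ col I z) ≤-refl ≤-refl)

  highestᵗ-cost : ∀ x xs → length (x ∷ xs) ≤ n → cost (highestᵗ I low hs hb rb x xs) ≤ 14 * (n * n)
  highestᵗ-cost x xs xs≤ = squared 14 (loop 11 (≤-trans (n≤1+n _) xs≤) (foldlᵗ-cost x xs λ b x →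
    ≤-trans (≤-reflexive (+-identityʳ _)) (∨ᵗ-cost (hb ! b <ᵗ hb ! x) _ ≤-refl
      (∧ᵗ-cost (hb ! b ==ᵗ hb ! x) (col I b ≤ᵗ col I x) ≤-refl ≤-refl))))

  accessibleInᵗ-cost : ∀ b {rem} → length rem ≤ n → cost (accessibleInᵗ I low hs hb rb b rem) ≤ 23 * (n * n)
  accessibleInᵗ-cost b {rem} rem≤ = loop² 20 rem≤ (filterᵗ-cost rem λ x →
    ∧-linear {3} {16} (col I x ==ᵗ col I b) (accessibleᵗ I low hs hb x) (linear 3) (accessibleᵗ-cost x))

  insertᵗ-length : ∀ y zs → length (value (insertᵗ I low hs hb rb y zs)) ≡ suc (length zs)
  insertᵗ-length y []       = refl
  insertᵗ-length y (z ∷ zs)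
    with value ((hb ! z <ᵗ hb ! y) ∨ᵗ (hb ! z ==ᵗ hb ! y) ∧ᵗ (col I y ≤ᵗ col I z))
  ... | true  = refl
  ... | false = cong suc (insertᵗ-length y zs)

  insertᵗ-cost : ∀ y zs → cost (insertᵗ I low hs hb rb y zs) ≤ 1 + length zs * 12
  insertᵗ-cost y []       = ≤-refl
  insertᵗ-cost y (z ∷ zs) = begin
    cost p + rest (value p)    ≤⟨ +-mono-≤ (earlierᵗ-cost y z) (rest≤ (value p)) ⟩
    11 + (2 + length zs * 12)  ≡⟨⟩
    1 + (12 + length zs * 12)  ∎
    where
    open ≤-Reasoning
    p : Timed Bool
    p = (hb ! z <ᵗ hb ! y) ∨ᵗ (hb ! z ==ᵗ hb ! y) ∧ᵗ (col I y ≤ᵗ col I z)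
    continue : Bool → Timed (List (Fin n))
    continue b = if b then return (y ∷ z ∷ zs) else do
      tick
      zs′ ← insertᵗ I low hs hb rb y zs
      return (z ∷ zs′)
    rest : Bool → ℕ
    rest b = cost (continue b)
    rest≤ : ∀ b → rest b ≤ 2 + length zs * 12
    rest≤ true  = z≤n
    rest≤ false = s≤s (≤-trans (≤-reflexive (+-identityʳ _)) (insertᵗ-cost y zs))

  sortᵗ-cost : ∀ {Y} → length Y ≤ n → cost (sortᵗ I low hs hb rb Y) ≤ 16 * (n * n)
  sortᵗ-cost {Y} Y≤ = loop² 13 Y≤ (go [] Y Y≤)
    where
    open ≤-Reasoning
    go : ∀ ys xs → length ys + length xs ≤ n →
         cost (foldlᵗ (λ ys y → insertᵗ I low hs hb rb y ys) ys xs) ≤ 1 + length xs * (2 + 13 * n)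
    go ys []       _  = ≤-refl
    go ys (x ∷ xs) ≤n = begin
      1 + (cost (insertᵗ I low hs hb rb x ys) + cost (foldlᵗ (λ ys y → insertᵗ I low hs hb rb y ys) ys′ xs))
        ≤⟨ s≤s (+-mono-≤ insert≤ (go ys′ xs ≤n′)) ⟩
      1 + (13 * n + (1 + length xs * (2 + 13 * n)))
        ≡⟨ cong suc (+-suc (13 * n) _) ⟩
      2 + 13 * n + length xs * (2 + 13 * n)
        ≤⟨ n≤1+n _ ⟩
      1 + (2 + 13 * n + length xs * (2 + 13 * n)) ∎
      where
      ys′ : List (Fin n)
      ys′ = value (insertᵗ I low hs hb rb x ys)
      ≤n′ : length ys′ + length xs ≤ n
      ≤n′ = ≤-trans (≤-reflexive
        (trans (cong (_+ length xs) (insertᵗ-length x ys)) (sym (+-suc (length ys) _)))) ≤n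
      insert≤ : cost (insertᵗ I low hs hb rb x ys) ≤ 13 * n
      insert≤ = ≤-trans (insertᵗ-cost x ys) (_⊞_ {n} {a = 1} {12} (linear 1)
        (≤-trans (*-monoˡ-≤ 12 (m+n≤o⇒m≤o (length ys) ≤n)) (≤-reflexive (*-comm n 12))))

  retrieveᵗ-cost : ∀ {Y rest} → length Y ≤ n → length rest ≤ n →
                   cost (retrieveᵗ I low hs hb rb Y rest) ≤ 40 * (n * n)
  retrieveᵗ-cost {Y} {rest} Y≤ rest≤ =
    _⊞_ {n * n} {a = 7} {33} (squared 7 (loop 4 Y≤ (foldlᵗ-cost hs Y λ v y → ≤-refl)))
      (_⊞_ {n * n} {a = 16} {17} (drops rb)
        (_⊞_ {n * n} {a = 1} {16} (squared 1 (≤-reflexive (sym (*-identityˡ n))))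
        (≤-trans (≤-reflexive (+-identityʳ _)) (drops hb))))
    where
    drops : ∀ v → cost (foldlᵗ (dropTargetᵗ I low hs hb rb Y) v rest) ≤ 16 * (n * n)
    drops v = loop² 13 rest≤ (foldlᵗ-cost v rest λ v x →
      _⊞_ {n} {a = 12} {1} (_⊞_ {n} {a = 1} {11} (linear 1) (_⊞_ {n} {a = 10} {1}
        (loop 7 Y≤ (countᵗ-cost Y λ y → ∧ᵗ-cost (col I y ==ᵗ col I x) (hb ! y <ᵗ hb ! x) ≤-refl ≤-refl))
        (linear 1))) (linear 1))

-- Correctness of the parts of a cycle

module _ {m n : ℕ} (I : Instance m n) where
  open Instance I

  module _ (low hs : Vector ℕ m) (hb rb : Vector ℕ n) where

    Lower : Fin n → Fin n → Set
    Lower y z = hb y < hb z ⊎ hb y ≡ hb z × stack y Fin.≤ stack z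

    lower-trans : ∀ {x y z} → Lower x y → Lower y z → Lower x z
    lower-trans (inj₁ x<y)       (inj₁ y<z)       = inj₁ (<-trans x<y y<z)
    lower-trans (inj₁ x<y)       (inj₂ (y≡z , _)) = inj₁ (<-≤-trans x<y (≤-reflexive y≡z))
    lower-trans (inj₂ (x≡y , _)) (inj₁ y<z)       = inj₁ (≤-<-trans (≤-reflexive x≡y) y<z)
    lower-trans (inj₂ (x≡y , s)) (inj₂ (y≡z , t)) = inj₂ (trans x≡y y≡z , ≤-trans s t)

    lower-total : ∀ {y z} → ¬ Lower y z → Lower z y
    lower-total {y} {z} ¬l with <-cmp (hb y) (hb z)
    ... | tri< y<z _ _ = contradiction (inj₁ y<z) ¬l
    ... | tri> _ _ z<y = inj₁ z<y
    ... | tri≈ _ y≡z _ with ≤-total (toℕ (stack y)) (toℕ (stack z))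
    ...   | inj₁ s≤t = contradiction (inj₂ (y≡z , s≤t)) ¬l
    ...   | inj₂ t≤s = inj₂ (sym y≡z , t≤s)

    lowerᵗ-reflects : ∀ y z → Reflects (Lower y z)
      (value ((hb ! y <ᵗ hb ! z) ∨ᵗ (hb ! y ==ᵗ hb ! z) ∧ᵗ (col I y ≤ᵗ col I z)))
    lowerᵗ-reflects y z = <ᵇ-reflects-< _ _ ∨ʳ ≡ᵇ-reflects-≡ _ _ ∧ʳ ≤ᵇ-reflects-≤ _ _

    highestᵗ-highest : ∀ b xs → let r = value (highestᵗ I low hs hb rb b xs) in
                       r ∈ b ∷ xs × (∀ {y} → y ∈ b ∷ xs → Lower y r)
    highestᵗ-highest b [] = here refl , λ { (here refl) → inj₂ (refl , ≤-refl) }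
    highestᵗ-highest b (x ∷ xs)
      with value ((hb ! b <ᵗ hb ! x) ∨ᵗ (hb ! b ==ᵗ hb ! x) ∧ᵗ (col I b ≤ᵗ col I x))
         | lowerᵗ-reflects b x
    ... | true  | ofʸ b≤x with r∈ , top ← highestᵗ-highest x xs =
          there r∈ , λ { (here refl) → lower-trans b≤x (top (here refl)) ; (there y∈) → top y∈ }
    ... | false | ofⁿ b≰x with r∈ , top ← highestᵗ-highest b xs =
          (case r∈ of λ { (here r≡b) → here r≡b ; (there r∈xs) → there (there r∈xs) }) ,
          λ { (here refl)          → top (here refl)
            ; (there (here refl))  → lower-trans (lower-total b≰x) (top (here refl))
            ; (there (there y∈xs)) → top (there y∈xs) }

    before-trans : ∀ {x y z} → Before I hb x y → Before I hb y z → Before I hb x z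
    before-trans (inj₁ y<x)       (inj₁ z<y)       = inj₁ (<-trans z<y y<x)
    before-trans (inj₁ y<x)       (inj₂ (z≡y , _)) = inj₁ (≤-<-trans (≤-reflexive z≡y) y<x)
    before-trans (inj₂ (y≡x , _)) (inj₁ z<y)       = inj₁ (<-≤-trans z<y (≤-reflexive y≡x))
    before-trans (inj₂ (y≡x , s)) (inj₂ (z≡y , t)) = inj₂ (trans z≡y y≡x , ≤-trans s t)

    before-total : ∀ {y z} → ¬ Before I hb y z → Before I hb z y
    before-total {y} {z} ¬b with <-cmp (hb y) (hb z)
    ... | tri< y<z _ _ = inj₁ y<z
    ... | tri> _ _ z<y = contradiction (inj₁ z<y) ¬b
    ... | tri≈ _ y≡z _ with ≤-total (toℕ (stack y)) (toℕ (stack z))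
    ...   | inj₁ s≤t = contradiction (inj₂ (sym y≡z , s≤t)) ¬b
    ...   | inj₂ t≤s = inj₂ (y≡z , t≤s)

    beforeᵗ-reflects : ∀ y z → Reflects (Before I hb y z)
      (value ((hb ! z <ᵗ hb ! y) ∨ᵗ (hb ! z ==ᵗ hb ! y) ∧ᵗ (col I y ≤ᵗ col I z)))
    beforeᵗ-reflects y z = <ᵇ-reflects-< _ _ ∨ʳ ≡ᵇ-reflects-≡ _ _ ∧ʳ ≤ᵇ-reflects-≤ _ _

    insertᵗ-sorted : ∀ y zs → Sorted I hb zs →
      value (insertᵗ I low hs hb rb y zs) ↭ y ∷ zs × Sorted I hb (value (insertᵗ I low hs hb rb y zs))
    insertᵗ-sorted y []       _ = ↭-refl , [] ∷ []
    insertᵗ-sorted y (z ∷ zs) (z≤ ∷ sorted)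
      with value ((hb ! z <ᵗ hb ! y) ∨ᵗ (hb ! z ==ᵗ hb ! y) ∧ᵗ (col I y ≤ᵗ col I z))
         | beforeᵗ-reflects y z
    ... | true  | ofʸ y≤z = ↭-refl , (y≤z ∷ All.map (before-trans y≤z) z≤) ∷ z≤ ∷ sorted
    ... | false | ofⁿ y≰z with ins↭ , ins-sorted ← insertᵗ-sorted y zs sorted =
          ↭-trans (↭-prep z ins↭) (↭-swap z y ↭-refl) ,
          All.tabulate (λ w∈ → case ∈-resp-↭ ins↭ w∈ of λ
            { (here refl) → before-total y≰z ; (there w∈zs) → All.lookup z≤ w∈zs }) ∷ ins-sorted

    sortᵗ-sorted : ∀ Y → value (sortᵗ I low hs hb rb Y) ↭ Y × Sorted I hb (value (sortᵗ I low hs hb rb Y))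
    sortᵗ-sorted Y = let r↭ , sorted = go [] Y [] in ↭-trans r↭ (↭-reflexive (++-identityʳ Y)) , sorted
      where
      go : ∀ ys xs → Sorted I hb ys →
           let r = value (foldlᵗ (λ ys y → insertᵗ I low hs hb rb y ys) ys xs) in
           r ↭ xs ++ ys × Sorted I hb r
      go ys []       sorted = ↭-refl , sorted
      go ys (x ∷ xs) sorted with ins↭ , ins-sorted ← insertᵗ-sorted x ys sorted
        with r↭ , r-sorted ← go _ xs ins-sorted =
        ↭-trans r↭ (↭-trans (++⁺ˡ xs ins↭) (shift x xs ys)) , r-sorted

    foldlᵗ-dropStack : ∀ (v : Vector ℕ m) Y t →
      value (foldlᵗ (dropStackᵗ I low hs hb rb) v Y) t ≡ v t ∸ count (inStack? I t) Y
    foldlᵗ-dropStack v []      t = refl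
    foldlᵗ-dropStack v (y ∷ Y) t with ih ← foldlᵗ-dropStack (value (dropStackᵗ I low hs hb rb v y)) Y t
      with stack y Fin.≟ t
    ... | yes refl = trans ih (trans (cong (_∸ count (inStack? I t) Y) (updateAt-updates (stack y) v))
                       (∸-+-assoc (v t) 1 _))
    ... | no  s≢t  = trans ih (cong (_∸ count (inStack? I t) Y)
                       (updateAt-minimal t (stack y) v (s≢t ∘ sym)))

    module _ (Y : List (Fin n)) where

      foldlᵗ-dropTarget-∉ : ∀ (v : Vector ℕ n) xs {x} → x ∉ xs →
        value (foldlᵗ (dropTargetᵗ I low hs hb rb Y) v xs) x ≡ v x
      foldlᵗ-dropTarget-∉ v []       _  = refl
      foldlᵗ-dropTarget-∉ v (y ∷ xs) x∉ = trans (foldlᵗ-dropTarget-∉ _ xs (x∉ ∘ there))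
        (updateAt-minimal _ y v (x∉ ∘ here))

      foldlᵗ-dropTarget-∈ : ∀ (v : Vector ℕ n) {xs x} → Unique xs → x ∈ xs →
        value (foldlᵗ (dropTargetᵗ I low hs hb rb Y) v xs) x ≡ v x ∸ value (countᵗ (belowᵗ I hb x) Y)
      foldlᵗ-dropTarget-∈ v {y ∷ xs} (y∉ ∷ xs!) (here refl) =
        trans (foldlᵗ-dropTarget-∉ _ xs (λ y∈ → All.lookup y∉ y∈ refl)) (updateAt-updates y v)
      foldlᵗ-dropTarget-∈ v {y ∷ xs} (y∉ ∷ xs!) (there x∈) =
        trans (foldlᵗ-dropTarget-∈ _ xs! x∈) (cong (_∸ value (countᵗ (belowᵗ I hb _) Y))
          (updateAt-minimal _ y v (λ x≡y → All.lookup y∉ x∈ (sym x≡y))))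

  record Represents (D : List (Fin n)) (st : State m n) : Set where
    open State st
    field
      tracks : Tracks I D hs hb
      ranks  : ∀ {b} → b ∉ D → rb b ≡ Rᴰ I D b
      split  : remaining ++ D ↭ allFin n

  retrieveᵗ-represents : ∀ {D hs hb rb Y bs rest} low → Unique D → Tracks I D hs hb →
    (∀ {b} → b ∉ D → rb b ≡ Rᴰ I D b) → bs ↭ Y → rest ++ Y ++ D ↭ allFin n →
    Represents (Y ++ D) (value (retrieveᵗ I low hs hb rb bs rest))
  retrieveᵗ-represents {D} {hs} {hb} {rb} {Y} {bs} {rest} low D! tracks ranks bs↭Y split = record
    { tracks = record
      { stacks  = λ t → begin
          value (foldlᵗ (dropStackᵗ I low hs hb rb) hs bs) t
            ≡⟨ foldlᵗ-dropStack low hs hb rb hs bs t ⟩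
          hs t ∸ count (inStack? I t) bs
            ≡⟨ cong₂ _∸_ (stacks t) (count-↭ (inStack? I t) bs↭Y) ⟩
          stackHeightᴰ I D t ∸ count (inStack? I t) Y
            ≡⟨ stackHeightᴰ-++ I Y D t ⟨
          stackHeightᴰ I (Y ++ D) t ∎
      ; targets = λ {b} b∉ → begin
          value (foldlᵗ (dropTargetᵗ I low hs hb rb bs) hb rest) b
            ≡⟨ foldlᵗ-dropTarget-∈ low hs hb rb bs hb left-unique (∉⇒∈ b∉) ⟩
          hb b ∸ value (countᵗ (belowᵗ I hb b) bs)
            ≡⟨ cong₂ _∸_ (targets (b∉ ∘ ∈-++⁺ʳ Y)) (below≡ b∉) ⟩
          heightᴰ I D b ∸ count (below? I b) Y
            ≡⟨ heightᴰ-++ I Y D b ⟨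
          heightᴰ I (Y ++ D) b ∎
      }
    ; ranks = λ {b} b∉ → begin
          value (foldlᵗ (dropTargetᵗ I low hs hb rb bs) rb rest) b
            ≡⟨ foldlᵗ-dropTarget-∈ low hs hb rb bs rb left-unique (∉⇒∈ b∉) ⟩
          rb b ∸ value (countᵗ (belowᵗ I hb b) bs)
            ≡⟨ cong₂ _∸_ (ranks (b∉ ∘ ∈-++⁺ʳ Y)) (below≡ b∉) ⟩
          Rᴰ I D b ∸ count (below? I b) Y
            ≡⟨ cong (_∸ count (below? I b) Y) (rank-++ b) ⟩
          count (below? I b) Y + Rᴰ I (Y ++ D) b ∸ count (below? I b) Y
            ≡⟨ m+n∸m≡n (count (below? I b) Y) _ ⟩
          Rᴰ I (Y ++ D) b ∎
    ; split = split
    }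
    where
    open ≡-Reasoning
    open Tracks tracks
    open Complement I rest split using (left-unique; right-unique; ∉⇒∈)
    ∉D : ∀ {y} → y ∈ bs → y ∉ D
    ∉D y∈ = proj₂ (proj₂ (Unique-++⁻ Y right-unique)) (∈-resp-↭ bs↭Y y∈)
    below≡ : ∀ {b} → b ∉ Y ++ D → value (countᵗ (belowᵗ I hb b) bs) ≡ count (below? I b) Y
    below≡ {b} b∉ = trans (countᵗ-value (below? I b) bs λ y∈ → reflects-map
        (λ (s≡ , y<b) → let s≡′ = Fin.toℕ-injective s≡ in s≡′ , heightᴰ-cancel-< I D! b∉D s≡′
          (subst₂ _<_ (targets (∉D y∈)) (targets b∉D) y<b))
        (λ (s≡ , y<b) → cong toℕ s≡ , subst₂ _<_ (sym (targets (∉D y∈))) (sym (targets b∉D))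
          (heightᴰ-mono-< I D! (∉D y∈) s≡ y<b))
        (≡ᵇ-reflects-≡ _ _ ∧ʳ <ᵇ-reflects-< _ _))
      (count-↭ (below? I b) bs↭Y)
      where
      b∉D : b ∉ D
      b∉D = b∉ ∘ ∈-++⁺ʳ Y
    rank-++ : ∀ b → Rᴰ I D b ≡ count (below? I b) Y + Rᴰ I (Y ++ D) b
    rank-++ b = +-cancelˡ-≡ (count (below? I b) D) _ _ (begin
      count (below? I b) D + Rᴰ I D b
        ≡⟨ trans (below-split I D! b) (sym (below-split I right-unique b)) ⟩
      count (below? I b) (Y ++ D) + Rᴰ I (Y ++ D) b
        ≡⟨ cong (_+ Rᴰ I (Y ++ D) b) (trans (count-++ (below? I b) Y D) (+-comm (count (below? I b) Y) _)) ⟩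
      count (below? I b) D + count (below? I b) Y + Rᴰ I (Y ++ D) b
        ≡⟨ +-assoc (count (below? I b) D) _ _ ⟩
      count (below? I b) D + (count (below? I b) Y + Rᴰ I (Y ++ D) b) ∎)

-- Batches and runs

module _ {m n : ℕ} (I : Instance m n) where
  open Instance I

  -- Bounds filtering the candidates (96), looking one up (1) and removing it (6).
  step : ℕ
  step = 103 * (n * n)

  module _ {D : List (Fin n)} {hs : Vector ℕ m} {hb rb : Vector ℕ n} (D! : Unique D)
    (tracks : Tracks I D hs hb) (ranks : ∀ {b} → b ∉ D → rb b ≡ Rᴰ I D b)
    (choose : Chooser n) (a : Fin n) where

    private
      1≤n : 1 ≤ n
      1≤n = ≤-trans (s≤s z≤n) (Fin.toℕ<n a)
      module Cost = Costs I 1≤n (low I) hs hb rb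
      open Linear 1≤n using (squared; quadratic)

    record Grown (paid : ℕ) (Y₀ : List (Fin n)) (r : Timed (List (Fin n) × List (Fin n))) : Set where
      field
        growing : Growing I D a (proj₂ (value r)) (proj₁ (value r))
        maximal : ∀ b → ¬ Legal I D (proj₁ (value r)) a b
        cost≤   : paid + cost r + step * length Y₀ ≤ step * suc (length (proj₁ (value r)))

    growing-∷ : ∀ {b cand cand′ Y} → Growing I D a cand Y → cand ↭ b ∷ cand′ → Legal I D Y a b →
                Growing I D a cand′ (b ∷ Y)
    growing-∷ {b} {cand} {cand′} {Y} growing cand↭ legal = record
      { batch    = extend batch anchor legal
      ; anchor   = there (proj₁ anchor) , λ { _ (here refl) → left ; y (there y∈) → proj₂ anchor y y∈ }
      ; shape    = shape′
      ; split    = ↭-trans (shift b cand′ (Y ++ D)) (↭-trans (++⁺ʳ (Y ++ D) (↭-sym cand↭)) split)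
      ; supplied = Feasible⇒Supplied I (Shape.fresh shape′) staysFeasible
      }
      where
      open Growing growing
      open Legal legal
      shape′ : Shape I D a (b ∷ Y)
      shape′ = shape-extend I shape anchor notRetrieved notInBatch
        (Accessible⇒Reachable I D accessible) left extends

    stopped : ∀ {paid cand Y} → paid ≤ step → Growing I D a cand Y → (∀ b → ¬ Legal I D Y a b) →
              Grown paid Y (return (Y , cand))
    stopped {paid} {Y = Y} paid≤ growing maximal = record
      { growing = growing
      ; maximal = maximal
      ; cost≤   = begin
          paid + 0 + step * length Y
            ≤⟨ +-monoˡ-≤ (step * length Y) (≤-trans (≤-reflexive (+-identityʳ paid)) paid≤) ⟩
          step + step * length Y
            ≡⟨ *-suc step (length Y) ⟨
          step * suc (length Y) ∎
      }
      where open ≤-Reasoning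

    legal⇒∈ : ∀ {cand Y b} → Growing I D a cand Y → Legal I D Y a b → b ∈ cand
    legal⇒∈ {cand} {Y} growing legal = Complement.∉⇒∈ I cand (Growing.split growing)
      ([ Legal.notInBatch legal , Legal.notRetrieved legal ]′ ∘ ∈-++⁻ Y)

    growᵗ-grown : ∀ fuel {cand Y} → Growing I D a cand Y → length cand ≤ fuel →
                  Grown 0 Y (growᵗ I (low I) hs hb rb fuel choose a cand Y)
    pickᵗ-grown : ∀ fuel {paid cand Y} ls → Growing I D a cand Y → length cand ≤ suc fuel →
                  paid ≤ 96 * (n * n) → length ls ≤ n →
                  (∀ {b} → b ∈ ls → b ∈ cand × Legal I D Y a b) → (∀ {b} → Legal I D Y a b → b ∈ ls) →
                  Grown paid Y (pickᵗ I (low I) hs hb rb fuel choose a cand Y ls)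

    growᵗ-grown zero       {[]} growing _ =
      stopped z≤n growing λ b legal → case legal⇒∈ growing legal of λ ()
    growᵗ-grown (suc fuel) {cand} {Y} growing cand≤ = record { Grown picked }
      where
      open Complement I cand (Growing.split growing) using (length≤)
      Y≤ : length Y ≤ n
      Y≤ = ≤-trans (m≤m+n _ _) (≤-trans (≤-reflexive (sym (length-++ Y))) (≤-trans (m≤n+m _ (length cand))
             (≤-reflexive (trans (sym (length-++ cand))
               (trans (↭-length (Growing.split growing)) (length-tabulate id))))))
      reflects : ∀ {b} → b ∈ cand → Reflects (Legal I D Y a b) (value (legalᵗ I (low I) hs hb rb a cand Y b))
      reflects = legalᵗ-reflects I D! tracks ranks growing
      picked : Grown (cost (filterᵗ (legalᵗ I (low I) hs hb rb a cand Y) cand)) Y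
                 (pickᵗ I (low I) hs hb rb fuel choose a cand Y
                   (value (filterᵗ (legalᵗ I (low I) hs hb rb a cand Y) cand)))
      picked = pickᵗ-grown fuel _ growing cand≤ (Cost.legal-filter-cost a {cand} {Y} length≤ Y≤)
        (≤-trans (filterᵗ-length _ cand) length≤) (∈-filterᵗ⁻ _ cand reflects)
        (λ legal → ∈-filterᵗ⁺ _ reflects (legal⇒∈ growing legal) legal)

    pickᵗ-grown fuel []           growing _ paid≤ _ _ complete =
      stopped (≤-trans paid≤ (*-monoˡ-≤ (n * n) (m≤m+n 96 7))) growing
        λ b legal → case complete legal of λ ()
    pickᵗ-grown fuel {paid} {cand} {Y} ls@(_ ∷ ls′) growing cand≤ paid≤ ls≤ sound _ = record
      { growing = Grown.growing grown
      ; maximal = Grown.maximal grown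
      ; cost≤   = begin
          paid + (length ls + (removal + cost r)) + step * length Y
            ≡⟨ regroup paid (length ls) removal (cost r) (step * length Y) ⟩
          paid + length ls + removal + (cost r + step * length Y)
            ≤⟨ +-monoˡ-≤ _ (≤-trans (+-mono-≤ (+-mono-≤ paid≤
                 (squared 1 (≤-trans ls≤ (≤-reflexive (sym (*-identityˡ n))))))
                 (Cost.removeᵗ-cost b {cand} length≤)) (≤-reflexive (units (n * n)))) ⟩
          step + (cost r + step * length Y)
            ≡⟨ swap-front step (cost r) (step * length Y) ⟩
          cost r + (step + step * length Y)
            ≡⟨ cong (cost r +_) (*-suc step (length Y)) ⟨
          cost r + step * suc (length Y)
            ≤⟨ Grown.cost≤ grown ⟩
          step * suc (length (proj₁ (value r))) ∎
      }
      where
      open ≤-Reasoning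
      open Complement I cand (Growing.split growing) using (length≤; left-unique)
      b : Fin n
      b = lookup ls (choose cand Y (length ls′))
      b∈ : b ∈ ls
      b∈ = ∈-lookup {xs = ls} (choose cand Y (length ls′))
      cand′ : List (Fin n)
      cand′ = value (removeᵗ I (low I) hs hb rb b cand)
      removal : ℕ
      removal = cost (removeᵗ I (low I) hs hb rb b cand)
      cand↭ : cand ↭ b ∷ cand′
      cand↭ = removeᵗ-↭ I (low I) hs hb rb left-unique (proj₁ (sound b∈))
      r : Timed (List (Fin n) × List (Fin n))
      r = growᵗ I (low I) hs hb rb fuel choose a cand′ (b ∷ Y)
      grown : Grown 0 (b ∷ Y) r
      grown = growᵗ-grown fuel (growing-∷ growing cand↭ (proj₂ (sound b∈)))
        (s≤s⁻¹ (≤-trans (≤-reflexive (sym (↭-length cand↭))) cand≤))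
      regroup : ∀ p l k c y → p + (l + (k + c)) + y ≡ p + l + k + (c + y)
      regroup = solve-∀
      swap-front : ∀ s c y → s + (c + y) ≡ c + (s + y)
      swap-front = solve-∀
      units : ∀ q → 96 * q + 1 * q + 6 * q ≡ 103 * q
      units = solve-∀

  record Outcome (D : List (Fin n)) (paid size : ℕ) (r : Timed (List (Plan n))) : Set where
    field
      {batches} : List (List (Fin n))
      run       : Run I D batches
      planned   : Planned I D (value r) batches
      cost≤     : paid + cost r ≤ 218 * (n * n) * size

  done : ∀ {D size} → (∀ b → b ∈ D) → Outcome D 0 size (return [])
  done all∈ = record { run = finished all∈ ; planned = finished all∈ ; cost≤ = z≤n }

  private
    total-cost : ∀ {q y r p h k g s e t c} → 1 ≤ y →
      p ≤ 37 * q → h ≤ 14 * q → k ≤ 6 * q → g ≤ 103 * q * y → s ≤ 16 * q → e ≤ 1 * q → t ≤ 40 * q →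
      1 ≤ q → c ≤ 218 * q * r →
      p + (h + (k + (g + (s + (e + (t + (c + 1))))))) ≤ 218 * q * (r + y)
    total-cost {q} {y} {r} {p} {h} {k} {g} {s} {e} {t} {c} 1≤y p≤ h≤ k≤ g≤ s≤ e≤ t≤ 1≤q c≤ = begin
      p + (h + (k + (g + (s + (e + (t + (c + 1)))))))
        ≤⟨ +-mono-≤ p≤ (+-mono-≤ h≤ (+-mono-≤ k≤ (+-mono-≤ g≤ (+-mono-≤ s≤ (+-mono-≤ e≤ (+-mono-≤ t≤
             (+-mono-≤ c≤ 1≤q))))))) ⟩
      37 * q + (14 * q + (6 * q + (103 * q * y + (16 * q + (1 * q + (40 * q + (218 * q * r + q)))))))
        ≡⟨ gather q y r ⟩
      115 * q * 1 + (103 * q * y + 218 * q * r)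
        ≤⟨ +-monoˡ-≤ (103 * q * y + 218 * q * r) (*-monoʳ-≤ (115 * q) 1≤y) ⟩
      115 * q * y + (103 * q * y + 218 * q * r)
        ≡⟨ combine q y r ⟩
      218 * q * (r + y) ∎
      where
      open ≤-Reasoning
      gather : ∀ q y r →
        37 * q + (14 * q + (6 * q + (103 * q * y + (16 * q + (1 * q + (40 * q + (218 * q * r + q)))))))
        ≡ 115 * q * 1 + (103 * q * y + 218 * q * r)
      gather = solve-∀
      combine : ∀ q y r → 115 * q * y + (103 * q * y + 218 * q * r) ≡ 218 * q * (r + y)
      combine = solve-∀

  remaining-∈ : ∀ {D} → [] ++ D ↭ allFin n → ∀ b → b ∈ D
  remaining-∈ split b = ∈-resp-↭ (↭-sym split) (∈-allFin b)

  module _ (choose : Chooser n) where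

    cyclesᵗ-correct : ∀ fuel {D} st → Represents I D st → Supplied I D →
      length (State.remaining st) ≤ fuel →
      Outcome D 0 (length (State.remaining st)) (cyclesᵗ I (low I) choose fuel st)
    cycleᵗ-correct : ∀ fuel {D paid b hs hb rb rem} bs →
      Represents I D (mkState hs hb rb rem) → Supplied I D →
      length rem ≤ suc fuel → paid ≤ 37 * (n * n) → length bs ≤ n → Highest I D b →
      (∀ {x} → x ∈ bs → x ∈ rem × stack x ≡ stack b × Reachable I D x) →
      (∀ {x} → x ∉ D → stack x ≡ stack b → Reachable I D x → x ∈ bs) →
      Outcome D paid (length rem) (cycleᵗ I (low I) choose fuel (mkState hs hb rb rem) bs)

    cyclesᵗ-correct zero       (mkState _ _ _ [])       repr _ _ = done (remaining-∈ (Represents.split repr))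
    cyclesᵗ-correct (suc fuel) (mkState _ _ _ [])       repr _ _ = done (remaining-∈ (Represents.split repr))
    cyclesᵗ-correct (suc fuel) {D} (mkState hs hb rb rem@(x ∷ xs)) repr supp rem≤ = record
      { run = run ; planned = planned
      ; cost≤ = ≤-trans (≤-reflexive (sym (+-assoc (cost (highestᵗ I (low I) hs hb rb x xs)) _ _))) cost≤ }
      where
      open Represents repr
      open Complement I rem split using (length≤; right-unique; ∈⇒∉; ∉⇒∈)
      module Cost = Costs I (≤-trans (s≤s z≤n) (Fin.toℕ<n x)) (low I) hs hb rb
      b : Fin n
      b = value (highestᵗ I (low I) hs hb rb x xs)
      b∈ : b ∈ rem
      b∈ = proj₁ (highestᵗ-highest I (low I) hs hb rb x xs)
      top : ∀ {y} → y ∈ rem → Lower I (low I) hs hb rb y b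
      top = proj₂ (highestᵗ-highest I (low I) hs hb rb x xs)
      highest : Highest I D b
      highest = ∈⇒∉ b∈ , λ y y∉D →
        subst₂ (λ hy hb → hy < hb ⊎ hy ≡ hb × stack y Fin.≤ stack b)
          (Tracks.targets tracks y∉D) (Tracks.targets tracks (∈⇒∉ b∈)) (top (∉⇒∈ y∉D))
      reflects : ∀ {y} → y ∈ rem → Reflects (stack y ≡ stack b × Reachable I D y)
        (value ((col I y ==ᵗ col I b) ∧ᵗ accessibleᵗ I (low I) hs hb y))
      reflects y∈ = reflects-map Fin.toℕ-injective (cong toℕ) (≡ᵇ-reflects-≡ _ _)
        ∧ʳ accessibleᵗ-reflects I right-unique tracks ranks (∈⇒∉ y∈)
      open Outcome (cycleᵗ-correct fuel (value (accessibleInᵗ I (low I) hs hb rb b rem)) repr supp rem≤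
        (≤-trans (+-mono-≤ (Cost.highestᵗ-cost x xs length≤) (Cost.accessibleInᵗ-cost b {rem} length≤))
          (≤-reflexive (sym (*-distribʳ-+ (n * n) 14 23))))
        (≤-trans (filterᵗ-length (λ y → (col I y ==ᵗ col I b) ∧ᵗ accessibleᵗ I (low I) hs hb y) rem)
          length≤)
        highest (∈-filterᵗ⁻ _ rem reflects)
        (λ y∉D s≡ reach → ∈-filterᵗ⁺ _ reflects (∉⇒∈ y∉D) (s≡ , reach)))

    cycleᵗ-correct fuel {b = b} [] repr supp _ _ _ (b∉D , _) _ complete
      with _ , x∉D , s≡ , reach ← reachable-in-stack I
             (Complement.right-unique I _ (Represents.split repr)) supp (suc (height b)) b ≤-refl b∉D
      = case complete x∉D s≡ reach of λ ()
    cycleᵗ-correct fuel {D} {paid} {b} {hs} {hb} {rb} {rem} (x ∷ xs)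
      repr supp rem≤ paid≤ bs≤ highest sound complete =
      record
        { run     = cycle batch anchor maximal (Outcome.run rest-outcome)
        ; planned = subst (λ h → Planned I D (mkPlan h bs ∷ value r) (Y ∷ Outcome.batches rest-outcome))
            (sym (targets b′∉D)) (cycle shape (proj₁ sorted)
              (sorted-cong I (targets ∘ Y∉D ∘ ∈-resp-↭ (proj₁ sorted)) (proj₂ sorted))
              (Outcome.planned rest-outcome))
        ; cost≤   = ≤-trans (total-cost 1≤Y paid≤
            (Cost.highestᵗ-cost x xs bs≤) (Cost.removeᵗ-cost b′ {rem} length≤)
            grow≤ (Cost.sortᵗ-cost {Y} Y≤) (quadratic 1)
            (Cost.retrieveᵗ-cost {bs} {rest} sorted≤ rest≤) 1≤n*n (Outcome.cost≤ rest-outcome))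
            (≤-reflexive (cong (218 * (n * n) *_) (trans (+-comm (length rest) _) sizes)))
        }
      where
      open Represents repr using (tracks; ranks) renaming (split to rem-split)
      open Tracks tracks using (targets)
      open Complement I rem rem-split using (length≤; left-unique; right-unique; ∈⇒∉)
      1≤n : 1 ≤ n
      1≤n = ≤-trans (s≤s z≤n) (Fin.toℕ<n x)
      open Linear 1≤n using (quadratic; 1≤n*n)
      module Cost = Costs I 1≤n (low I) hs hb rb
      b′ : Fin n
      b′ = value (highestᵗ I (low I) hs hb rb x xs)
      b′∈ : b′ ∈ x ∷ xs
      b′∈ = proj₁ (highestᵗ-highest I (low I) hs hb rb x xs)
      b′∉D : b′ ∉ D
      b′∉D = ∈⇒∉ (proj₁ (sound b′∈))
      reach : Reachable I D b′
      reach = proj₂ (proj₂ (sound b′∈))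
      initial : Initial I D b′
      initial = b , highest , b′∉D , proj₁ (proj₂ (sound b′∈)) ,
        Reachable⇒Accessible I right-unique b′∉D reach ,
        λ y y∉D s≡ acc → subst₂ _≤_ (targets y∉D) (targets b′∉D) ([ <⇒≤ , ≤-reflexive ∘ proj₁ ]′
          (proj₂ (highestᵗ-highest I (low I) hs hb rb x xs)
            (complete y∉D s≡ (Accessible⇒Reachable I D acc))))
      cand : List (Fin n)
      cand = value (removeᵗ I (low I) hs hb rb b′ rem)
      rem↭ : rem ↭ b′ ∷ cand
      rem↭ = removeᵗ-↭ I (low I) hs hb rb left-unique (proj₁ (sound b′∈))
      growing₀ : Growing I D b′ cand [ b′ ]
      growing₀ = record
        { batch    = start initial
        ; anchor   = here refl , λ { _ (here refl) → ≤-refl }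
        ; shape    = shape-start I right-unique b′∉D reach
        ; split    = ↭-trans (shift b′ cand D) (↭-trans (++⁺ʳ D (↭-sym rem↭)) rem-split)
        ; supplied = supplied-start I right-unique supp initial
        }
      cand≤ : length cand ≤ n
      cand≤ = ≤-trans (n≤1+n _) (≤-trans (≤-reflexive (sym (↭-length rem↭))) length≤)
      grow : Timed (List (Fin n) × List (Fin n))
      grow = growᵗ I (low I) hs hb rb n choose b′ cand [ b′ ]
      open Grown (growᵗ-grown right-unique tracks ranks choose b′ n growing₀ cand≤)
        renaming (cost≤ to grow-cost≤)
      open Growing growing using (batch; anchor; shape; split; supplied)
      Y rest bs : List (Fin n)
      Y    = proj₁ (value grow)
      rest = proj₂ (value grow)
      bs   = value (sortᵗ I (low I) hs hb rb Y)
      sorted : bs ↭ Y × Sorted I hb bs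
      sorted = sortᵗ-sorted I (low I) hs hb rb Y
      Y∉D : ∀ {y} → y ∈ Y → y ∉ D
      Y∉D = proj₂ (proj₂ (Unique-++⁻ Y (Shape.fresh shape)))
      1≤Y : 1 ≤ length Y
      1≤Y = length>0 (Shape.first∈ shape)
        where
        length>0 : ∀ {y ys} → y ∈ ys → 1 ≤ length {A = Fin n} ys
        length>0 (here _)  = s≤s z≤n
        length>0 (there _) = s≤s z≤n
      sizes : length Y + length rest ≡ length rem
      sizes = +-cancelʳ-≡ (length D) _ _ (begin
        length Y + length rest + length D      ≡⟨ cong (_+ length D) (+-comm (length Y) _) ⟩
        length rest + length Y + length D      ≡⟨ +-assoc (length rest) _ _ ⟩
        length rest + (length Y + length D)    ≡⟨ cong (length rest +_) (length-++ Y) ⟨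
        length rest + length (Y ++ D)          ≡⟨ length-++ rest ⟨
        length (rest ++ Y ++ D)                ≡⟨ trans (↭-length split) (sym (↭-length rem-split)) ⟩
        length (rem ++ D)                      ≡⟨ length-++ rem ⟩
        length rem + length D                  ∎)
        where open ≡-Reasoning
      Y≤ : length Y ≤ n
      Y≤ = ≤-trans (≤-trans (m≤m+n _ _) (≤-reflexive sizes)) length≤
      sorted≤ : length bs ≤ n
      sorted≤ = ≤-trans (≤-reflexive (↭-length (proj₁ sorted))) Y≤
      rest≤ : length rest ≤ n
      rest≤ = ≤-trans (≤-trans (m≤n+m _ (length Y)) (≤-reflexive sizes)) length≤
      grow≤ : cost grow ≤ 103 * (n * n) * length Y
      grow≤ = +-cancelʳ-≤ step _ _ (begin
        cost grow + step             ≡⟨ cong (cost grow +_) (*-identityʳ step) ⟨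
        cost grow + step * 1         ≤⟨ grow-cost≤ ⟩
        step * suc (length Y)        ≡⟨ *-suc step (length Y) ⟩
        step + step * length Y       ≡⟨ +-comm step _ ⟩
        step * length Y + step       ∎)
        where open ≤-Reasoning
      st′ : State m n
      st′ = value (retrieveᵗ I (low I) hs hb rb bs rest)
      r : Timed (List (Plan n))
      r = cyclesᵗ I (low I) choose fuel st′
      rest-outcome : Outcome (Y ++ D) 0 (length rest) r
      rest-outcome = cyclesᵗ-correct fuel st′
        (retrieveᵗ-represents I (low I) right-unique tracks ranks (proj₁ sorted) split) supplied
        (s≤s⁻¹ (≤-trans (+-monoˡ-≤ (length rest) 1≤Y) (≤-trans (≤-reflexive sizes) rem≤)))

module _ {m n : ℕ} (I : Instance m n) where
  open Instance I

  run⇒planned : ∀ {D Ys} → Unique D → Run I D Ys → ∃[ ps ] Planned I D ps Ys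
  run⇒planned D! (finished all∈) = [] , finished all∈
  run⇒planned {D} D! (cycle {Y} batch _ _ run) with b₀ , shape ← batch-shape I D! batch
    with ps , planned ← run⇒planned (Shape.fresh shape) run
    with sorted↭ , sorted ← sortᵗ-sorted I stackHeight stackHeight (heightᴰ I D) height Y =
    _ , cycle shape sorted↭ sorted planned

  algorithm2-correct : Feasible I [] → ∀ choose →
    let output = algorithm2 I (value (prefixMinima stackHeight)) choose in
    ∃[ Ys ] Run I [] Ys × Planned I [] (value output) Ys × (1 ≤ n → cost output ≤ 230 * n ^ 3)
  algorithm2-correct feasible choose = batches , run , planned , bound
    where
    ranking : Timed (Vector ℕ n)
    ranking = tabulateᵗ (λ b → countᵗ (belowᵗ I height b) (allFin n))
    represents : Represents I [] (mkState stackHeight height (value ranking) (allFin n))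
    represents = record
      { tracks = record { stacks = λ _ → refl ; targets = λ _ → refl }
      ; ranks  = λ {b} _ → begin
          value ranking b
            ≡⟨ tabulateᵗ-value (λ b → countᵗ (belowᵗ I height b) (allFin n)) b ⟩
          value (countᵗ (belowᵗ I height b) (allFin n))
            ≡⟨ countᵗ-value (below? I b) (allFin n) (λ _ → reflects-map
                 (λ (s≡ , y<b) → Fin.toℕ-injective s≡ , y<b) (λ (s≡ , y<b) → cong toℕ s≡ , y<b)
                 (≡ᵇ-reflects-≡ _ _ ∧ʳ <ᵇ-reflects-< _ _)) ⟩
          count (below? I b) (allFin n)
            ≡⟨ below-split I [] b ⟨
          Rᴰ I [] b ∎
      ; split = ↭-reflexive (++-identityʳ (allFin n))
      }
      where open ≡-Reasoning
    open Outcome (cyclesᵗ-correct I choose n _ represents (Feasible⇒Supplied I [] feasible)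
                   (≤-reflexive (length-tabulate id)))
    bound : 1 ≤ n → cost (algorithm2 I (value (prefixMinima stackHeight)) choose) ≤ 230 * n ^ 3
    bound 1≤n = begin
      cost ranking + (n + _)
        ≤⟨ +-mono-≤ ranking≤ (+-monoʳ-≤ n cost≤) ⟩
      n * (1 + 10 * n) + (n + 218 * (n * n) * length (allFin n))
        ≡⟨ cong (λ k → n * (1 + 10 * n) + (n + 218 * (n * n) * k)) (length-tabulate id) ⟩
      n * (1 + 10 * n) + (n + 218 * (n * n) * n)
        ≡⟨ expand n ⟩
      2 * (1 * 1 * n) + 10 * (1 * n * n) + 218 * (n * n * n)
        ≤⟨ +-monoˡ-≤ _ (+-mono-≤ (*-monoʳ-≤ 2 (*-monoˡ-≤ n (*-mono-≤ 1≤n 1≤n)))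
             (*-monoʳ-≤ 10 (*-monoˡ-≤ n (*-monoˡ-≤ n 1≤n)))) ⟩
      2 * (n * n * n) + 10 * (n * n * n) + 218 * (n * n * n)
        ≡⟨ cube n ⟩
      230 * n ^ 3 ∎
      where
      open ≤-Reasoning
      ranking≤ : cost ranking ≤ n * (1 + 10 * n)
      ranking≤ = tabulateᵗ-cost _ λ b → Linear.loop 1≤n 7 (Linear.allFin≤ 1≤n)
        (countᵗ-cost (allFin n) λ y →
        ∧ᵗ-cost (col I y ==ᵗ col I b) (height ! y <ᵗ height ! b) ≤-refl ≤-refl)
      expand : ∀ k → k * (1 + 10 * k) + (k + 218 * (k * k) * k)
        ≡ 2 * (1 * 1 * k) + 10 * (1 * k * k) + 218 * (k * k * k)
      expand = solve-∀
      cube : ∀ k → 2 * (k * k * k) + 10 * (k * k * k) + 218 * (k * k * k) ≡ 230 * (k * (k * (k * 1)))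
      cube = solve-∀

theorem4 : (∀ {m n} (I : Instance m n) → Feasible I [] →
    ∀ Ys → Run I [] Ys →
    ∃[ sol ] FeasibleSolution I sol × Pointwise (λ c Y → Cycle.order c ↭ Y) sol Ys)
    ×
    (∃[ C ] ∀ {m n} (I : Instance m n) → Feasible I [] → (choose : Chooser n) →
    let low    = prefixMinima (Instance.stackHeight I)
        output = algorithm2 I (value low) choose
    in
    (∃[ Ys ] Run I [] Ys × Pointwise (λ p Y → Plan.sequence p ↭ Y) (value output) Ys)
    × FeasibleSolution I (decode I (value output))
    × cost low ≤ C * m
    × (1 ≤ n → cost output ≤ C * n ^ 3))
theorem4 =
  (λ I _ Ys run → let ps , planned = run⇒planned I [] run in
    decode I ps , planned⇒feasible I planned ,
    decode-pointwise I _ _ (planned⇒pointwise I planned)) ,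
  (230 , λ {m} I feasible choose →
    let Ys , run , planned , bound = algorithm2-correct I feasible choose in
    (Ys , run , planned⇒pointwise I planned) ,
    planned⇒feasible I planned ,
    ≤-trans (prefixMinima-cost (Instance.stackHeight I)) (*-monoˡ-≤ m (m≤m+n 4 226)) ,
    bound)
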